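{- Let $k\ge 2$ be an integer, let $a_1,\dots,a_k$ be positive integers, and let $b_1,\dots,b_k$ be integers. Assume that $a_ib_j\ne a_jb_i$ for every $1\le i<j\le k$. Then for any positive constant $C$, the set of positive integers $n$ for which \[ \frac{\phi(a_1n+b_1)}{\phi(a_2n+b_2)} > C, \quad \frac{\phi(a_2n+b_2)}{\phi(a_3n+b_3)} > C, \quad\dots,\quad \frac{\phi(a_{k-1}n+b_{k-1})}{\phi(a_kn+b_k)} > C \] all hold has positive lower density. In particular, the set of positive integers $n$ for which \[ \phi(a_1n+b_1) > \phi(a_2n+b_2) > \dots > \phi(a_kn+b_k) \] has positive lower density.
   Context: $\phi$ denotes the Euler phi-function on positive integers. The lower density of a set $S$ of positive integers is $\liminf_{x\to\infty} \frac1x\#\{n\in S: n\le x\}$. Only those $n$ for which every argument $a_in+b_i$ is positive are considered; this excludes only finitely many $n$ and does not affect lower density. -}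

module Defs where

open import Data.Fin.Base using (Fin; toℕ)
open import Data.Integer.Base as ℤ using (ℤ; +_; +[1+_]; ∣_∣)
open import Data.List.Base using (List; length; filter; applyUpTo)
open import Data.List.Properties using (filter-accept)
open import Data.List.Relation.Unary.All using (All)
open import Data.List.Relation.Unary.Unique.Propositional using (Unique)
open import Data.Nat.Base as ℕ using (ℕ; suc; NonZero)
open import Data.Nat.Coprimality using (coprime?; 1-coprimeTo)
open import Data.Product.Base using (Σ-syntax; ∃-syntax; _×_)
open import Data.Rational.Base as ℚ using (ℚ; 0ℚ; _/_)
open import Data.Sum.Base using (_⊎_)
open import Function.Bundles using (_⇔_)
open import Level using (0ℓ)
open import Relation.Binary.PropositionalEquality.Core using (_≡_; sym; cong; subst)
open import Relation.Nullary.Negation.Core using (¬_)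
open import Relation.Unary using (Pred; _∈_)

-- A real number is a two-sided Dedekind cut of the rationals.
record ℝ : Set₁ where
  field
    Lower Upper     : Pred ℚ 0ℓ
    lower-inhabited : ∃[ q ] q ∈ Lower
    upper-inhabited : ∃[ q ] q ∈ Upper
    lower-rounded   : ∀ q → q ∈ Lower ⇔ (∃[ r ] q ℚ.< r × r ∈ Lower)
    upper-rounded   : ∀ q → q ∈ Upper ⇔ (∃[ r ] r ℚ.< q × r ∈ Upper)
    disjoint        : ∀ q → ¬ (q ∈ Lower × q ∈ Upper)
    located         : ∀ {q r} → q ℚ.< r → q ∈ Lower ⊎ r ∈ Upper

infix 4 _ℚ<ℝ_ _ℝ<ℚ_

_ℚ<ℝ_ : ℚ → ℝ → Set
q ℚ<ℝ C = q ∈ ℝ.Lower C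

_ℝ<ℚ_ : ℝ → ℚ → Set
C ℝ<ℚ q = q ∈ ℝ.Upper C

-- Only the values at positive n are meaningful; φ 0 is 0.
φ : ℕ → ℕ
φ n = length (filter (λ j → coprime? j n) (applyUpTo suc n))

φ-nonZero : ∀ n → .{{NonZero n}} → NonZero (φ n)
φ-nonZero n@(suc m) =
  subst NonZero
    (sym (cong length
      (filter-accept (λ j → coprime? j n) {xs = applyUpTo (λ i → suc (suc i)) m}
        (1-coprimeTo n))))
    _

∣∣-nonZero : ∀ z → .{{ℤ.Positive z}} → NonZero ∣ z ∣
∣∣-nonZero +[1+ n ] = _

φ⁺ : (z : ℤ) → .{{ℤ.Positive z}} → ℕ
φ⁺ z = φ ∣ z ∣

φ⁺-nonZero : ∀ z → .{{_ : ℤ.Positive z}} → NonZero (φ⁺ z)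
φ⁺-nonZero z = φ-nonZero ∣ z ∣ {{∣∣-nonZero z}}

φ-ratio : (y z : ℤ) → .{{ℤ.Positive y}} → .{{ℤ.Positive z}} → ℚ
φ-ratio y z = _/_ (+ φ⁺ y) (φ⁺ z) {{φ⁺-nonZero z}}

-- m ≤ #{ n ∈ S : 1 ≤ n ≤ x }.  S need not be decidable, so its elements
-- cannot in general be counted by a function; m distinct ones are listed.
AtLeast : ℕ → Pred ℕ 0ℓ → ℕ → Set
AtLeast m S x =
  Σ[ ns ∈ List ℕ ]
    length ns ≡ m × Unique ns × All (λ n → 1 ℕ.≤ n × n ℕ.≤ x × n ∈ S) ns

-- q < liminf_{x→∞} #{ n ∈ S : 1 ≤ n ≤ x } / x, where liminf is the supremum
-- over N of the infima over x ≥ N: q lies strictly below such a supremum iff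
-- for some N a rational r > q bounds every quotient with x ≥ N from below.
_<lowerDensity_ : ℚ → Pred ℕ 0ℓ → Set
q <lowerDensity S =
  ∃[ r ] q ℚ.< r ×
    (∃[ N ] (∀ x → .{{_ : NonZero x}} → N ℕ.≤ x →
      ∃[ m ] AtLeast m S x × r ℚ.≤ + m / x))

PositiveLowerDensity : Pred ℕ 0ℓ → Set
PositiveLowerDensity S = 0ℚ <lowerDensity S

module _ {k : ℕ} (a : Fin k → ℕ) (b : Fin k → ℤ) where

  linear : Fin k → ℕ → ℤ
  linear i n = + a i ℤ.* + n ℤ.+ b i

  AllPositive : Pred ℕ 0ℓ
  AllPositive n = ∀ i → ℤ.Positive (linear i n)

  RatiosExceed : ℝ → Pred ℕ 0ℓ
  RatiosExceed C n =
    Σ[ pos ∈ AllPositive n ]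
      (∀ i j → toℕ j ≡ suc (toℕ i) →
        C ℝ<ℚ φ-ratio (linear i n) (linear j n) {{pos i}} {{pos j}})

  Decreasing : Pred ℕ 0ℓ
  Decreasing n =
    Σ[ pos ∈ AllPositive n ]
      (∀ i j → toℕ j ≡ suc (toℕ i) →
        φ⁺ (linear i n) {{pos i}} ℕ.> φ⁺ (linear j n) {{pos j}})

{-# OPTIONS --safe #-}
module Submission where

-- Write L_i(n) = a_i n + b_i. After a translation of n the b_i are positive
-- integers, and it suffices to find, for every natural number K, a positive
-- proportion of n with K φ(L_{i+1}(n)) < φ(L_i(n)) for all i; the real number
-- C enters only through a rational upper bound, and C = 1 gives the
-- decreasing chain.
--
-- Making φ(L_j) small. Let Q_0 be the factorial of a number exceeding a
-- multiple of k, all a_i, and all |a_i b_j - a_j b_i|. Choose successively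
-- D_j coprime to Q_j, with φ(D_j) / D_j tiny compared with 1 / Q_j, and put
-- Q_{j+1} = Q_j D_j, R = Q_k (`sparse`, `Tower`). By the Chinese remainder
-- theorem there is a residue class modulo R on which D_j divides L_j(n) for
-- every j (`simultaneous`), whence φ(L_j(n)) / L_j(n) ≤ φ(D_j) / D_j. Since a
-- common divisor of L_i(n) and L_j(n) divides a_j b_i - a_i b_j, the number
-- L_i(n) is then coprime to D_j for j > i, so that gcd(L_i(n), R) divides
-- Q_{i+1} (`gcd∣Q`).
--
-- The modulus D is a product of c_t = 1 + tQ over t < N. The integers c_t u
-- with u coprime to D are distinct for distinct t, so that the densities
-- φ(D) / (D c_t) of these sets have sum at most 1, while the sum of 1 / c_t
-- diverges. No prime numbers are needed.
--
-- Keeping φ(L_i) large. Among the integers congruent to 1 modulo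
-- g = gcd(L, R), those not coprime to L are divisible by some d > 1 that
-- divides L and is coprime to R; hence φ(L) ≥ (L / g) (1 - Σ 1/d) over these
-- d (`φ-lower`). Such d are large, because R is divisible by every small
-- integer, and each divides L_i(n) for about one in d of the n in the class.
-- The mean of Σ 1/d over the class is therefore at most about the sum of
-- 1 / d² over large d, which is small (`mean-roughSum`). By Markov's
-- inequality all k sums are at most 1/2 for at least a quarter of the class
-- (`markov`), and for these n
--   φ(L_i) ≥ L_i / (2 Q_{i+1}),   φ(L_{i+1}) ≤ L_{i+1} φ(D_{i+1}) / D_{i+1},
-- while L_{i+1} / L_i is bounded. This is `descends`.
--
-- All counts are finite sums of natural numbers. Sums of reciprocals are
-- cleared of denominators by a common multiple F.

open import Defs
open import Algebra.Bundles using (AbelianGroup)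
import Algebra.Properties.Group as Group
open import Data.Bool.Base using (if_then_else_)
open import Data.Empty using (⊥-elim)
open import Data.Fin.Base using (Fin; _<_; toℕ; fromℕ<)
open import Data.Fin.Properties using (fromℕ<-toℕ; toℕ-fromℕ<; toℕ<n)
open import Data.Integer.Base as ℤ using (ℤ; +_)
import Data.Integer.Properties as ℤ
import Data.Integer.Tactic.RingSolver as ℤ-Solver
open import Data.List.Base using (List; length; filter; applyUpTo; upTo; map)
open import Data.List.Properties using (length-map)
open import Data.List.Relation.Unary.All using (All)
import Data.List.Relation.Unary.All as AllBase
import Data.List.Relation.Unary.All.Properties as All
open import Data.List.Relation.Unary.Unique.Propositional using (Unique)
import Data.List.Relation.Unary.Unique.Propositional.Properties as Unique
open import Data.Nat.Base as ℕ using (ℕ; zero; suc; _+_; _*_; _∸_; _≤_; z≤n; s≤s; NonZero; _^_; _!; ∣_-_∣; >-nonZero; >-nonZero⁻¹; ≢-nonZero⁻¹)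
open import Data.Nat.Coprimality as Coprimality using (Coprime; coprime?)
open import Data.Nat.Divisibility
open import Data.Nat.DivMod using (_/_; _%_; m/n*n≤m; m≡m%n+[m/n]*n; m%n<n; m*n/n≡m; m/n*n≡m; /-monoˡ-≤; m≥n⇒m/n>0)
open import Data.Nat.GCD using (gcd; gcd[m,n]∣m; gcd[m,n]∣n; gcd-greatest; module Bézout)
open import Data.Nat.Properties
open import Data.Nat.Tactic.RingSolver using (solve-∀)
open import Data.Product.Base using (Σ; ∃-syntax; _×_; _,_; proj₁; proj₂)
open import Data.Rational.Base as ℚ using (0ℚ)
import Data.Rational.Properties as ℚ
import Data.Rational.Unnormalised.Base as ℚᵘ
import Data.Rational.Unnormalised.Properties as ℚᵘ
open import Data.Sum.Base using (inj₁; inj₂)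
open import Function.Bundles using (Equivalence)
open import Function.Base using (_∘_; it)
open import Relation.Binary.PropositionalEquality
open import Relation.Nullary using (Dec; yes; no; ¬_; does)
open import Relation.Nullary.Decidable using (_×-dec_)
open import Relation.Unary using (Pred; Decidable)

-- Finite sums

-- The sum of f i over 0 ≤ i < n.
∑ : ℕ → (ℕ → ℕ) → ℕ
∑ zero    f = 0
∑ (suc n) f = ∑ n f + f n

∑-≤ : ∀ n {f g : ℕ → ℕ} → (∀ i → i ℕ.< n → f i ≤ g i) → ∑ n f ≤ ∑ n g
∑-≤ zero    f≤g = z≤n
∑-≤ (suc n) f≤g = +-mono-≤ (∑-≤ n (λ i i<n → f≤g i (m<n⇒m<1+n i<n))) (f≤g n (n<1+n n))

∑-cong : ∀ n {f g : ℕ → ℕ} → (∀ i → i ℕ.< n → f i ≡ g i) → ∑ n f ≡ ∑ n g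
∑-cong zero    f≡g = refl
∑-cong (suc n) f≡g = cong₂ _+_ (∑-cong n (λ i i<n → f≡g i (m<n⇒m<1+n i<n))) (f≡g n (n<1+n n))

∑-+ : ∀ n (f g : ℕ → ℕ) → ∑ n (λ i → f i + g i) ≡ ∑ n f + ∑ n g
∑-+ zero    f g = refl
∑-+ (suc n) f g = trans (cong (_+ (f n + g n)) (∑-+ n f g)) (interchange (∑ n f) (∑ n g) (f n) (g n))
  where
  interchange : ∀ p q r s → p + q + (r + s) ≡ p + r + (q + s)
  interchange = solve-∀

∑-*ˡ : ∀ c n (f : ℕ → ℕ) → ∑ n (λ i → c * f i) ≡ c * ∑ n f
∑-*ˡ c zero    f = sym (*-zeroʳ c)
∑-*ˡ c (suc n) f = trans (cong (_+ c * f n) (∑-*ˡ c n f)) (sym (*-distribˡ-+ c (∑ n f) (f n)))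

∑-const : ∀ n c → ∑ n (λ _ → c) ≡ n * c
∑-const zero    c = refl
∑-const (suc n) c = trans (cong (_+ c) (∑-const n c)) (+-comm (n * c) c)

∑-≤-const : ∀ n {f : ℕ → ℕ} {c} → (∀ i → i ℕ.< n → f i ≤ c) → ∑ n f ≤ n * c
∑-≤-const n {c = c} f≤c = ≤-trans (∑-≤ n f≤c) (≤-reflexive (∑-const n c))

∑-≥-const : ∀ n {f : ℕ → ℕ} {c} → (∀ i → i ℕ.< n → c ≤ f i) → n * c ≤ ∑ n f
∑-≥-const n {c = c} c≤f = ≤-trans (≤-reflexive (sym (∑-const n c))) (∑-≤ n c≤f)

∑-swap : ∀ m n (f : ℕ → ℕ → ℕ) → ∑ m (λ i → ∑ n (f i)) ≡ ∑ n (λ j → ∑ m (λ i → f i j))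
∑-swap zero    n f = sym (trans (∑-const n 0) (*-zeroʳ n))
∑-swap (suc m) n f =
  trans (cong (_+ ∑ n (f m)) (∑-swap m n f)) (sym (∑-+ n (λ j → ∑ m (λ i → f i j)) (f m)))

∑-split : ∀ m n (f : ℕ → ℕ) → ∑ (m + n) f ≡ ∑ m f + ∑ n (λ i → f (m + i))
∑-split m zero    f = trans (cong (λ x → ∑ x f) (+-identityʳ m)) (sym (+-identityʳ _))
∑-split m (suc n) f =
  trans (cong (λ x → ∑ x f) (+-suc m n))
    (trans (cong (_+ f (m + n)) (∑-split m n f)) (+-assoc (∑ m f) _ _))

∑-first : ∀ n (f : ℕ → ℕ) → ∑ (suc n) f ≡ f 0 + ∑ n (f ∘ suc)
∑-first = ∑-split 1

∑-extend : ∀ {m n} (f : ℕ → ℕ) → m ≤ n → ∑ m f ≤ ∑ n f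
∑-extend {m} {n} f m≤n = begin
  ∑ m f                                ≤⟨ m≤m+n _ _ ⟩
  ∑ m f + ∑ (n ∸ m) (λ i → f (m + i))  ≡⟨ ∑-split m (n ∸ m) f ⟨
  ∑ (m + (n ∸ m)) f                    ≡⟨ cong (λ x → ∑ x f) (m+[n∸m]≡n m≤n) ⟩
  ∑ n f                                ∎
  where open ≤-Reasoning

term≤∑ : ∀ {i n} (f : ℕ → ℕ) → i ℕ.< n → f i ≤ ∑ n f
term≤∑ {i} f i<n = ≤-trans (m≤n+m (f i) (∑ i f)) (∑-extend f i<n)

∑-blocks : ∀ m d (f : ℕ → ℕ) → ∑ (m * d) f ≡ ∑ m (λ j → ∑ d (λ r → f (j * d + r)))
∑-blocks zero    d f = refl
∑-blocks (suc m) d f = begin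
  ∑ (d + m * d) f                                ≡⟨ cong (λ x → ∑ x f) (+-comm d (m * d)) ⟩
  ∑ (m * d + d) f                                ≡⟨ ∑-split (m * d) d f ⟩
  ∑ (m * d) f + ∑ d (λ r → f (m * d + r))        ≡⟨ cong (_+ ∑ d (λ r → f (m * d + r))) (∑-blocks m d f) ⟩
  ∑ (suc m) (λ j → ∑ d (λ r → f (j * d + r)))    ∎
  where open ≡-Reasoning

abstract
  -- The indicator of a decidable proposition. It is abstract so that the
  -- decision procedures, which involve gcd, are never unfolded.
  𝟙 : {A : Set} → Dec A → ℕ
  𝟙 d = if does d then 1 else 0

  𝟙-yes : {A : Set} (d : Dec A) → A → 𝟙 d ≡ 1
  𝟙-yes (yes _) _ = refl
  𝟙-yes (no ¬a) a = ⊥-elim (¬a a)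

  𝟙-no : {A : Set} (d : Dec A) → ¬ A → 𝟙 d ≡ 0
  𝟙-no (yes a) ¬a = ⊥-elim (¬a a)
  𝟙-no (no _)  _  = refl

𝟙-mono : {A B : Set} (d : Dec A) (e : Dec B) → (A → B) → 𝟙 d ≤ 𝟙 e
𝟙-mono (yes a) e f = ≤-reflexive (trans (𝟙-yes (yes a) a) (sym (𝟙-yes e (f a))))
𝟙-mono (no ¬a) e f = ≤-trans (≤-reflexive (𝟙-no (no ¬a) ¬a)) z≤n

𝟙-cong : {A B : Set} (d : Dec A) (e : Dec B) → (A → B) → (B → A) → 𝟙 d ≡ 𝟙 e
𝟙-cong d e f g = ≤-antisym (𝟙-mono d e f) (𝟙-mono e d g)

∑-𝟙-none : ∀ n {P : Pred ℕ _} (P? : Decidable P) → (∀ i → i ℕ.< n → ¬ P i) →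
  ∑ n (λ i → 𝟙 (P? i)) ≡ 0
∑-𝟙-none n P? none =
  trans (∑-cong n (λ i i<n → 𝟙-no (P? i) (none i i<n))) (trans (∑-const n 0) (*-zeroʳ n))

∑-𝟙-atMostOne : ∀ n {P : Pred ℕ _} (P? : Decidable P) →
  (∀ i j → i ℕ.< n → j ℕ.< n → P i → P j → i ≡ j) →
  ∑ n (λ i → 𝟙 (P? i)) ≤ 1
∑-𝟙-atMostOne zero    P? unique = z≤n
∑-𝟙-atMostOne (suc n) P? unique with P? n
... | no ¬pn = ≤-trans (≤-reflexive (trans (cong (λ x → ∑ n (λ i → 𝟙 (P? i)) + x) (𝟙-no (no ¬pn) ¬pn)) (+-identityʳ _)))
  (∑-𝟙-atMostOne n P? (λ i j i<n j<n → unique i j (m<n⇒m<1+n i<n) (m<n⇒m<1+n j<n)))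
... | yes pn = ≤-reflexive (cong₂ _+_ (∑-𝟙-none n P? none) (𝟙-yes (yes pn) pn))
  where
  none : ∀ i → i ℕ.< n → ¬ _
  none i i<n pi = <⇒≢ i<n (unique i n (m<n⇒m<1+n i<n) (n<1+n n) pi pn)

length-filter-applyUpTo : ∀ n (f : ℕ → ℕ) {P : Pred ℕ _} (P? : Decidable P) →
  length (filter P? (applyUpTo f n)) ≡ ∑ n (λ i → 𝟙 (P? (f i)))
length-filter-applyUpTo zero    f P? = refl
length-filter-applyUpTo (suc n) f P? =
  trans head-first (sym (∑-first n (λ i → 𝟙 (P? (f i)))))
  where
  head-first : length (filter P? (applyUpTo f (suc n)))
             ≡ 𝟙 (P? (f 0)) + ∑ n (λ i → 𝟙 (P? (f (suc i))))
  head-first with P? (f 0)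
  ... | yes p0 = cong₂ _+_ (sym (𝟙-yes (yes p0) p0)) (length-filter-applyUpTo n (f ∘ suc) P?)
  ... | no ¬p0 = cong₂ _+_ (sym (𝟙-no (no ¬p0) ¬p0)) (length-filter-applyUpTo n (f ∘ suc) P?)

-- The totient as a count

φ-sum : ∀ n → φ n ≡ ∑ n (λ i → 𝟙 (coprime? (suc i) n))
φ-sum n = length-filter-applyUpTo n suc (λ j → coprime? j n)

-- The residues 1, …, n may be replaced by 0, …, n - 1.
φ-sum₀ : ∀ n → φ n ≡ ∑ n (λ i → 𝟙 (coprime? i n))
φ-sum₀ n = +-cancelʳ-≡ (f 0) (φ n) (∑ n f) (begin
  φ n + f 0                       ≡⟨ cong (_+ f 0) (φ-sum n) ⟩
  ∑ n (f ∘ suc) + f 0             ≡⟨ +-comm (∑ n (f ∘ suc)) (f 0) ⟩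
  f 0 + ∑ n (f ∘ suc)             ≡⟨ ∑-first n f ⟨
  ∑ n f + f n                     ≡⟨ cong (λ x → ∑ n f + x) ends ⟩
  ∑ n f + f 0                     ∎)
  where
  open ≡-Reasoning
  f : ℕ → ℕ
  f i = 𝟙 (coprime? i n)
  ends : f n ≡ f 0
  ends = 𝟙-cong (coprime? n n) (coprime? 0 n)
    (λ c {_} (_ , d∣n) → c (d∣n , d∣n)) (λ c {d} (d∣n , _) → c (d ∣0 , d∣n))

coprime-∣ : ∀ {m n m′ n′} → m′ ∣ m → n′ ∣ n → Coprime m n → Coprime m′ n′
coprime-∣ m′∣m n′∣n c (d∣m′ , d∣n′) = c (∣-trans d∣m′ m′∣m , ∣-trans d∣n′ n′∣n)

coprime-* : ∀ {m n o} → Coprime m o → Coprime n o → Coprime (m * n) o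
coprime-* {m} {n} {o} cm cn {d} (d∣mn , d∣o) =
  cn (Coprimality.coprime-divisor {o = n} (Coprimality.sym (coprime-∣ ∣-refl d∣o cm)) d∣mn , d∣o)

-- Every block of D consecutive integers contains φ D that are coprime to D.
count-coprime : ∀ m D → ∑ (m * D) (λ i → 𝟙 (coprime? i D)) ≡ m * φ D
count-coprime m D = begin
  ∑ (m * D) (λ i → 𝟙 (coprime? i D))                      ≡⟨ ∑-blocks m D _ ⟩
  ∑ m (λ j → ∑ D (λ r → 𝟙 (coprime? (j * D + r) D)))      ≡⟨ ∑-cong m (λ j _ → ∑-cong D (λ r _ → shift j r)) ⟩
  ∑ m (λ j → ∑ D (λ r → 𝟙 (coprime? r D)))                ≡⟨ ∑-const m _ ⟩
  m * ∑ D (λ r → 𝟙 (coprime? r D))                        ≡⟨ cong (m *_) (φ-sum₀ D) ⟨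
  m * φ D                                                 ∎
  where
  open ≡-Reasoning
  shift : ∀ j r → 𝟙 (coprime? (j * D + r) D) ≡ 𝟙 (coprime? r D)
  shift j r = 𝟙-cong (coprime? (j * D + r) D) (coprime? r D)
    (λ c {_} (d∣r , d∣D) → c (∣m∣n⇒∣m+n (∣n⇒∣m*n j d∣D) d∣r , d∣D))
    (λ c {_} (d∣s , d∣D) → c (∣m+n∣m⇒∣n d∣s (∣n⇒∣m*n j d∣D) , d∣D))

-- φ(L) / L ≤ φ(D) / D for D dividing L.
φ-∣-≤ : ∀ {D L} → D ∣ L → D * φ L ≤ L * φ D
φ-∣-≤ {D} (divides m refl) = begin
  D * φ (m * D)                                    ≡⟨ cong (D *_) (φ-sum₀ (m * D)) ⟩
  D * ∑ (m * D) (λ i → 𝟙 (coprime? i (m * D)))     ≤⟨ *-monoʳ-≤ D (∑-≤ (m * D) (λ i _ → 𝟙-mono (coprime? i (m * D)) (coprime? i D) (coprime-∣ ∣-refl (n∣m*n m)))) ⟩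
  D * ∑ (m * D) (λ i → 𝟙 (coprime? i D))           ≡⟨ cong (D *_) (count-coprime m D) ⟩
  D * (m * φ D)                                    ≡⟨ rearrange D m (φ D) ⟩
  m * D * φ D                                      ∎
  where
  open ≤-Reasoning
  rearrange : ∀ D m p → D * (m * p) ≡ m * D * p
  rearrange = solve-∀

-- Moduli coprime to a given integer with a small totient ratio

-- The terms 1 + tQ, all coprime to Q.
progression : ℕ → ℕ → ℕ
progression Q t = suc (t * Q)

progressionProduct : ℕ → ℕ → ℕ
progressionProduct Q zero    = 1
progressionProduct Q (suc N) = progressionProduct Q N * progression Q N

progression-∣ : ∀ Q {t N} → t ℕ.< N → progression Q t ∣ progressionProduct Q N
progression-∣ Q {t} {suc N} (s≤s t≤N) with m≤n⇒m<n∨m≡n t≤N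
... | inj₁ t<N  = ∣m⇒∣m*n (progression Q N) (progression-∣ Q t<N)
... | inj₂ refl = n∣m*n (progressionProduct Q N)

progression-coprime : ∀ Q t → Coprime (progression Q t) Q
progression-coprime Q t {d} (d∣p , d∣Q) =
  ∣1⇒≡1 (∣m+n∣m⇒∣n (subst (d ∣_) (+-comm 1 (t * Q)) d∣p) (∣n⇒∣m*n t d∣Q))

progressionProduct-coprime : ∀ Q N → Coprime (progressionProduct Q N) Q
progressionProduct-coprime Q zero    = Coprimality.1-coprimeTo Q
progressionProduct-coprime Q (suc N) =
  coprime-* (progressionProduct-coprime Q N) (progression-coprime Q N)

progressionProduct-nonZero : ∀ Q N → NonZero (progressionProduct Q N)
progressionProduct-nonZero Q zero    = _
progressionProduct-nonZero Q (suc N) =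
  m*n≢0 (progressionProduct Q N) (progression Q N) {{progressionProduct-nonZero Q N}}

-- The integers c u with c ∣ D and u coprime to D determine c.
coprime-cofactor-unique : ∀ {D c c′ u u′} → c ∣ D → c′ ∣ D → Coprime u D → Coprime u′ D →
  u * c ≡ u′ * c′ → c ≡ c′
coprime-cofactor-unique {D} {c} {c′} {u} {u′} c∣D c′∣D cu cu′ eq =
  ∣-antisym (one-way {u = u} c∣D cu′ eq) (one-way {u = u′} c′∣D cu (sym eq))
  where
  one-way : ∀ {c c′ u u′} → c ∣ D → Coprime u′ D → u * c ≡ u′ * c′ → c ∣ c′
  one-way {u = u} c∣D cu′ eq =
    Coprimality.coprime-divisor (Coprimality.sym (coprime-∣ ∣-refl c∣D cu′)) (divides u (sym eq))

module _ (Q N : ℕ) .{{_ : NonZero Q}} where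

  private
    D : ℕ
    D = progressionProduct Q N

    -- The factors of D and their cofactors.
    c w : ℕ → ℕ
    c t = progression Q t
    w t = D / progression Q t

    instance
      D≢0 : NonZero D
      D≢0 = progressionProduct-nonZero Q N

    w*c≡D : ∀ {t} → t ℕ.< N → w t * c t ≡ D
    w*c≡D t<N = m/n*n≡m (progression-∣ Q t<N)

    -- v is c t times an integer coprime to D.
    Multiple : ℕ → ℕ → Set
    Multiple v t = c t ∣ v × Coprime (v / progression Q t) D

    Multiple? : ∀ v t → Dec (Multiple v t)
    Multiple? v t = (c t ∣? v) ×-dec coprime? (v / progression Q t) D

    unique : ∀ v s t → s ℕ.< N → t ℕ.< N → Multiple v s → Multiple v t → s ≡ t
    unique v s t s<N t<N (c∣v , cop) (c′∣v , cop′) =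
      *-cancelʳ-≡ s t Q (suc-injective (coprime-cofactor-unique
        (progression-∣ Q s<N) (progression-∣ Q t<N) cop cop′
        (trans (m/n*n≡m c∣v) (sym (m/n*n≡m c′∣v)))))

    length≡ : ∀ {t} → t ℕ.< N → w t * D * c t ≡ D * D
    length≡ {t} t<N = trans (rearrange (w t) D (c t)) (cong (D *_) (w*c≡D t<N))
      where
      rearrange : ∀ w D c → w * D * c ≡ D * (w * c)
      rearrange = solve-∀

    -- Only the first term of each block of length c t is kept.
    multiples : ∀ t → t ℕ.< N → φ D * w t ≤ ∑ (D * D) (λ v → 𝟙 (Multiple? v t))
    multiples t t<N = begin
      φ D * w t                                                              ≡⟨ *-comm (φ D) (w t) ⟩
      w t * φ D                                                              ≡⟨ count-coprime (w t) D ⟨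
      ∑ (w t * D) (λ j → 𝟙 (coprime? j D))                                   ≤⟨ ∑-≤ (w t * D) (λ j _ → first j) ⟩
      ∑ (w t * D) (λ j → ∑ (c t) (λ r → 𝟙 (Multiple? (j * c t + r) t)))      ≡⟨ ∑-blocks (w t * D) (c t) (λ v → 𝟙 (Multiple? v t)) ⟨
      ∑ (w t * D * c t) (λ v → 𝟙 (Multiple? v t))                            ≡⟨ cong (λ x → ∑ x (λ v → 𝟙 (Multiple? v t))) (length≡ t<N) ⟩
      ∑ (D * D) (λ v → 𝟙 (Multiple? v t))                                    ∎
      where
      open ≤-Reasoning
      first : ∀ j → 𝟙 (coprime? j D) ≤ ∑ (c t) (λ r → 𝟙 (Multiple? (j * c t + r) t))
      first j = ≤-trans
        (𝟙-mono (coprime? j D) (Multiple? (j * c t + 0) t)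
          (λ cop → subst (λ v → Multiple v t) (sym (+-identityʳ (j * c t)))
            (n∣m*n j , subst (λ u → Coprime u D) (sym (m*n/n≡m j (progression Q t))) cop)))
        (term≤∑ (λ r → 𝟙 (Multiple? (j * c t + r) t)) (s≤s z≤n))

  -- The sets Multiple t within [0, D²) are disjoint.
  ∑-cofactors-φ : ∑ N w * φ D ≤ D * D
  ∑-cofactors-φ = begin
    ∑ N w * φ D                                             ≡⟨ *-comm (∑ N w) (φ D) ⟩
    φ D * ∑ N w                                             ≡⟨ ∑-*ˡ (φ D) N w ⟨
    ∑ N (λ t → φ D * w t)                                   ≤⟨ ∑-≤ N multiples ⟩
    ∑ N (λ t → ∑ (D * D) (λ v → 𝟙 (Multiple? v t)))         ≡⟨ ∑-swap N (D * D) _ ⟩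
    ∑ (D * D) (λ v → ∑ N (λ t → 𝟙 (Multiple? v t)))         ≤⟨ ∑-≤-const (D * D) (λ v _ → ∑-𝟙-atMostOne N (Multiple? v) (unique v)) ⟩
    D * D * 1                                               ≡⟨ *-identityʳ (D * D) ⟩
    D * D                                                   ∎
    where open ≤-Reasoning

-- Doubling the range adds at least a fixed amount to the sum of 1 / (1 + tQ).
∑-cofactors-diverges : ∀ Q N D (w : ℕ → ℕ) → (∀ t → t ℕ.< N → w t * progression Q t ≡ D) →
  ∀ s → 2 ^ s ≤ N → s * D ≤ suc (2 * Q) * ∑ (2 ^ s) w
∑-cofactors-diverges Q N D w wc≡D zero    _      = z≤n
∑-cofactors-diverges Q N D w wc≡D (suc s) 2ˢ⁺¹≤N = begin
  D + s * D                                             ≤⟨ +-mono-≤ upper (∑-cofactors-diverges Q N D w wc≡D s (≤-trans (m≤m+n n (n + 0)) 2ˢ⁺¹≤N)) ⟩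
  suc (2 * Q) * ∑ n w′ + suc (2 * Q) * ∑ n w            ≡⟨ *-distribˡ-+ (suc (2 * Q)) (∑ n w′) (∑ n w) ⟨
  suc (2 * Q) * (∑ n w′ + ∑ n w)                        ≡⟨ cong (suc (2 * Q) *_) (+-comm (∑ n w′) (∑ n w)) ⟩
  suc (2 * Q) * (∑ n w + ∑ n w′)                        ≡⟨ cong (suc (2 * Q) *_) (∑-split n n w) ⟨
  suc (2 * Q) * ∑ (n + n) w                             ≡⟨ cong (λ x → suc (2 * Q) * ∑ (n + x) w) (+-identityʳ n) ⟨
  suc (2 * Q) * ∑ (n + (n + 0)) w                       ∎
  where
  open ≤-Reasoning
  n : ℕ
  n = 2 ^ s
  w′ : ℕ → ℕ
  w′ i = w (n + i)
  instance
    n≢0 : NonZero n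
    n≢0 = m^n≢0 2 s
  n+i<N : ∀ {i} → i ℕ.< n → n + i ℕ.< N
  n+i<N i<n = ≤-trans (+-monoʳ-< n i<n) (≤-trans (+-monoʳ-≤ n (m≤m+n n 0)) 2ˢ⁺¹≤N)
  small : ∀ {i} → i ℕ.< n → progression Q (n + i) ≤ n * suc (2 * Q)
  small {i} i<n = begin
    1 + (n + i) * Q       ≤⟨ +-mono-≤ (>-nonZero⁻¹ n) (*-monoˡ-≤ Q (+-monoʳ-≤ n (<⇒≤ i<n))) ⟩
    n + (n + n) * Q       ≡⟨ rearrange n Q ⟩
    n * suc (2 * Q)       ∎
    where
    rearrange : ∀ n Q → n + (n + n) * Q ≡ n * (1 + 2 * Q)
    rearrange = solve-∀
  term : ∀ i → i ℕ.< n → D ≤ n * suc (2 * Q) * w′ i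
  term i i<n = begin
    D                                  ≡⟨ wc≡D (n + i) (n+i<N i<n) ⟨
    w′ i * progression Q (n + i)       ≤⟨ *-monoʳ-≤ (w′ i) (small i<n) ⟩
    w′ i * (n * suc (2 * Q))           ≡⟨ *-comm (w′ i) _ ⟩
    n * suc (2 * Q) * w′ i             ∎
  upper : D ≤ suc (2 * Q) * ∑ n w′
  upper = *-cancelˡ-≤ n (begin
    n * D                                      ≤⟨ ∑-≥-const n term ⟩
    ∑ n (λ i → n * suc (2 * Q) * w′ i)         ≡⟨ ∑-*ˡ (n * suc (2 * Q)) n w′ ⟩
    n * suc (2 * Q) * ∑ n w′                   ≡⟨ *-assoc n _ _ ⟩
    n * (suc (2 * Q) * ∑ n w′)                 ∎)

-- A modulus coprime to Q whose totient ratio is at most 1 / W.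
record Sparse (Q W : ℕ) : Set where
  field
    modulus    : ℕ
    nonZero    : NonZero modulus
    coprime    : Coprime modulus Q
    φ-small    : φ modulus * W ≤ modulus

abstract
  sparse : ∀ Q W → .{{NonZero Q}} → Sparse Q W
  sparse Q W = record
    { modulus = D
    ; nonZero = progressionProduct-nonZero Q N
    ; coprime = progressionProduct-coprime Q N
    ; φ-small = *-cancelʳ-≤ (φ D * W) D D (begin
        φ D * W * D      ≡⟨ *-assoc (φ D) W D ⟩
        φ D * (W * D)    ≤⟨ *-monoʳ-≤ (φ D) W*D≤ ⟩
        φ D * ∑ N w      ≡⟨ *-comm (φ D) (∑ N w) ⟩
        ∑ N w * φ D      ≤⟨ ∑-cofactors-φ Q N ⟩
        D * D            ∎)
    }
    where
    open ≤-Reasoning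
    s N D : ℕ
    -- s doublings bring the sum of 1 / (1 + tQ) above W.
    s = suc (2 * Q) * W
    N = 2 ^ s
    D = progressionProduct Q N
    w : ℕ → ℕ
    w t = D / progression Q t
    instance
      D≢0 : NonZero D
      D≢0 = progressionProduct-nonZero Q N
    W*D≤ : W * D ≤ ∑ N w
    W*D≤ = *-cancelˡ-≤ (suc (2 * Q)) (begin
      suc (2 * Q) * (W * D)    ≡⟨ *-assoc (suc (2 * Q)) W D ⟨
      s * D                    ≤⟨ ∑-cofactors-diverges Q N D w (λ t t<N → m/n*n≡m (progression-∣ Q t<N)) s ≤-refl ⟩
      suc (2 * Q) * ∑ N w      ∎)

-- Solutions of linear congruences

∣-∣-∣ : ∀ {d m n} → d ∣ m → d ∣ n → d ∣ ∣ m - n ∣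
∣-∣-∣ {d} (divides p refl) (divides q refl) = divides ∣ p - q ∣ (sym (*-distribʳ-∣-∣ d p q))

-- A progression whose difference is coprime to d has at most one multiple of d
-- in any d consecutive terms.
count-multiples : ∀ {d} A B m → Coprime d A → ∑ (m * d) (λ t → 𝟙 (d ∣? A * t + B)) ≤ m
count-multiples {d} A B m d⊥A = begin
  ∑ (m * d) (λ t → 𝟙 (d ∣? A * t + B))                        ≡⟨ ∑-blocks m d _ ⟩
  ∑ m (λ j → ∑ d (λ r → 𝟙 (d ∣? A * (j * d + r) + B)))        ≤⟨ ∑-≤-const m (λ j _ → ∑-𝟙-atMostOne d (λ r → d ∣? A * (j * d + r) + B) (unique j)) ⟩
  m * 1                                                       ≡⟨ *-identityʳ m ⟩
  m                                                           ∎
  where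
  open ≤-Reasoning
  difference : ∀ j r s → ∣ A * (j * d + r) + B - A * (j * d + s) + B ∣ ≡ A * ∣ r - s ∣
  difference j r s = begin-equality
    ∣ A * (j * d + r) + B - A * (j * d + s) + B ∣     ≡⟨ cong₂ ∣_-_∣ (+-comm _ B) (+-comm _ B) ⟩
    ∣ B + A * (j * d + r) - B + A * (j * d + s) ∣     ≡⟨ ∣m+n-m+o∣≡∣n-o∣ B _ _ ⟩
    ∣ A * (j * d + r) - A * (j * d + s) ∣             ≡⟨ *-distribˡ-∣-∣ A _ _ ⟨
    A * ∣ j * d + r - j * d + s ∣                     ≡⟨ cong (A *_) (∣m+n-m+o∣≡∣n-o∣ (j * d) r s) ⟩
    A * ∣ r - s ∣                                     ∎
  unique : ∀ j r s → r ℕ.< d → s ℕ.< d →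
    d ∣ A * (j * d + r) + B → d ∣ A * (j * d + s) + B → r ≡ s
  unique j r s r<d s<d d∣r d∣s with ∣ r - s ∣ in eq
    | Coprimality.coprime-divisor d⊥A (subst (d ∣_) (difference j r s) (∣-∣-∣ d∣r d∣s))
  ... | zero  | _   = ∣m-n∣≡0⇒m≡n eq
  ... | suc e | d∣e = ⊥-elim (>⇒∤ (≤-<-trans (≤-reflexive (sym eq))
                        (≤-<-trans (∣m-n∣≤m⊔n r s) (⊔-lub r<d s<d))) d∣e)

count-multiples-≤ : ∀ {d} A B T .{{_ : NonZero d}} → Coprime d A →
  ∑ T (λ t → 𝟙 (d ∣? A * t + B)) ≤ suc (T / d)
count-multiples-≤ {d} A B T d⊥A =
  ≤-trans (∑-extend (λ t → 𝟙 (d ∣? A * t + B)) T≤) (count-multiples A B (suc (T / d)) d⊥A)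
  where
  open ≤-Reasoning
  T≤ : T ≤ suc (T / d) * d
  T≤ = begin
    T                        ≡⟨ m≡m%n+[m/n]*n T d ⟩
    T % d + T / d * d        ≤⟨ +-monoˡ-≤ (T / d * d) (<⇒≤ (m%n<n T d)) ⟩
    d + T / d * d            ∎

-- With y d = 1 + x A the solution is t = x B; with x A = 1 + y d the minus
-- sign is supplied by the factor d - 1.
solve-congruence : ∀ {A d} → .{{NonZero d}} → Coprime A d → ∀ B → ∃[ t ] d ∣ A * t + B
solve-congruence {A} {suc d} A⊥d B with Coprimality.coprime-Bézout A⊥d
... | Bézout.+- x y eq = x * (B * d) , divides (y * (B * d) + B) (begin
    A * (x * (B * d)) + B                ≡⟨ left A x B d ⟩
    x * A * (B * d) + B                  ≡⟨ cong (λ e → e * (B * d) + B) eq ⟨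
    (1 + y * suc d) * (B * d) + B        ≡⟨ right y d B ⟩
    (y * (B * d) + B) * suc d            ∎)
  where
  open ≡-Reasoning
  left : ∀ A x B d → A * (x * (B * d)) + B ≡ x * A * (B * d) + B
  left = solve-∀
  right : ∀ y d B → (1 + y * (1 + d)) * (B * d) + B ≡ (y * (B * d) + B) * (1 + d)
  right = solve-∀
... | Bézout.-+ x y eq = x * B , divides (y * B) (begin
    A * (x * B) + B          ≡⟨ left A x B ⟩
    (1 + x * A) * B          ≡⟨ cong (_* B) eq ⟩
    y * suc d * B            ≡⟨ right y d B ⟩
    y * B * suc d            ∎)
  where
  open ≡-Reasoning
  left : ∀ A x B → A * (x * B) + B ≡ (1 + x * A) * B
  left = solve-∀
  right : ∀ y d B → y * (1 + d) * B ≡ y * B * (1 + d)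
  right = solve-∀

-- A lower bound for the totient

-- w d is the integer F / d for 1 ≤ d ≤ X.
Reciprocals : ℕ → ℕ → (ℕ → ℕ) → Set
Reciprocals F X w = ∀ d → 1 ≤ d → d ≤ X → d * w d ≡ F

-- d is a nontrivial divisor of L coprime to R.
Rough : ℕ → ℕ → ℕ → Set
Rough R L d = 1 ℕ.< d × d ∣ L × Coprime d R

Rough? : ∀ R L d → Dec (Rough R L d)
Rough? R L d = (1 <? d) ×-dec ((d ∣? L) ×-dec coprime? d R)

-- F times the sum of 1 / d over the divisors 1 < d ≤ X of L coprime to R.
roughSum : ℕ → (ℕ → ℕ) → ℕ → ℕ → ℕ
roughSum R w X L = ∑ (suc X) (λ d → 𝟙 (Rough? R L d) * w d)

module _ (R F X L : ℕ) (w : ℕ → ℕ) (w-reciprocal : Reciprocals F X w)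
  {{_ : NonZero L}} (L≤X : L ≤ X) where

  private
    -- The candidates are the m = L / g integers 1 + s g with s < m.
    g m : ℕ
    g = gcd L R
    g∣L : g ∣ L
    g∣L = gcd[m,n]∣m L R
    m = quotient g∣L
    L≡ : L ≡ m * g
    L≡ = m∣n⇒n≡quotient*m g∣L
    instance
      g≢0 : NonZero g
      g≢0 = m*n≢0⇒n≢0 m {{subst NonZero L≡ it}}

    coprime-candidates : ∑ m (λ s → 𝟙 (coprime? (suc (s * g)) L)) ≤ φ L
    coprime-candidates = begin
      ∑ m (λ s → 𝟙 (coprime? (suc (s * g)) L))                   ≤⟨ ∑-≤ m (λ s _ → first s) ⟩
      ∑ m (λ s → ∑ g (λ r → 𝟙 (coprime? (suc (s * g + r)) L)))   ≡⟨ ∑-blocks m g (λ i → 𝟙 (coprime? (suc i) L)) ⟨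
      ∑ (m * g) (λ i → 𝟙 (coprime? (suc i) L))                   ≡⟨ cong (λ x → ∑ x (λ i → 𝟙 (coprime? (suc i) L))) L≡ ⟨
      ∑ L (λ i → 𝟙 (coprime? (suc i) L))                         ≡⟨ φ-sum L ⟨
      φ L                                                        ∎
      where
      open ≤-Reasoning
      first : ∀ s → 𝟙 (coprime? (suc (s * g)) L) ≤ ∑ g (λ r → 𝟙 (coprime? (suc (s * g + r)) L))
      first s = ≤-trans
        (≤-reflexive (cong (λ x → 𝟙 (coprime? (suc x) L)) (sym (+-identityʳ (s * g)))))
        (term≤∑ (λ r → 𝟙 (coprime? (suc (s * g + r)) L)) (>-nonZero⁻¹ g))

    -- The rough divisor d of L divides the candidate 1 + s g.
    hit : ℕ → ℕ → ℕ
    hit s d = 𝟙 (Rough? R L d) * 𝟙 (d ∣? g * s + 1)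

    -- For a candidate not coprime to L, its gcd with L is a rough divisor.
    cover : ∀ s → 1 ≤ 𝟙 (coprime? (suc (s * g)) L) + ∑ (suc X) (hit s)
    cover s = by-cases (coprime? (suc (s * g)) L)
      where
      open ≤-Reasoning
      d : ℕ
      d = gcd (suc (s * g)) L
      d∣ : d ∣ suc (s * g)
      d∣ = gcd[m,n]∣m (suc (s * g)) L
      d∣L : d ∣ L
      d∣L = gcd[m,n]∣n (suc (s * g)) L
      d∣′ : d ∣ g * s + 1
      d∣′ = subst (d ∣_) (trans (+-comm 1 (s * g)) (cong (_+ 1) (*-comm s g))) d∣
      d≤X : d ≤ X
      d≤X = ≤-trans (∣⇒≤ d∣L) L≤X
      d≢0 : d ≢ 0
      d≢0 d≡0 = ≢-nonZero⁻¹ L (0∣⇒≡0 (subst (_∣ L) d≡0 d∣L))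
      d-rough : ¬ Coprime (suc (s * g)) L → Rough R L d
      d-rough ¬c = ≤∧≢⇒< (n≢0⇒n>0 d≢0) (¬c ∘ λ 1≡d → Coprimality.gcd≡1⇒coprime (sym 1≡d)) , d∣L , λ {e} (e∣d , e∣R) →
        ∣1⇒≡1 (∣m+n∣m⇒∣n (∣-trans e∣d d∣′) (∣m⇒∣m*n s (gcd-greatest (∣-trans e∣d d∣L) e∣R)))
      by-cases : Dec (Coprime (suc (s * g)) L) →
        1 ≤ 𝟙 (coprime? (suc (s * g)) L) + ∑ (suc X) (hit s)
      by-cases (yes c) = ≤-trans (≤-reflexive (sym (𝟙-yes (coprime? (suc (s * g)) L) c))) (m≤m+n _ _)
      by-cases (no ¬c) = begin
        1                    ≡⟨ cong₂ _*_ (𝟙-yes (Rough? R L d) (d-rough ¬c)) (𝟙-yes (d ∣? g * s + 1) d∣′) ⟨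
        hit s d              ≤⟨ term≤∑ (hit s) (s≤s d≤X) ⟩
        ∑ (suc X) (hit s)    ≤⟨ m≤n+m _ (𝟙 (coprime? (suc (s * g)) L)) ⟩
        𝟙 (coprime? (suc (s * g)) L) + ∑ (suc X) (hit s)    ∎

    -- A rough divisor d is coprime to g, hence divides m and hits at most m / d
    -- candidates.
    few : ∀ d → d ℕ.< suc X → F * ∑ m (λ s → hit s d) ≤ m * (𝟙 (Rough? R L d) * w d)
    few d (s≤s d≤X) = by-cases (Rough? R L d)
      where
      open ≤-Reasoning
      vanish : ∀ w → F * 0 ≡ m * (0 * w)
      vanish w = trans (*-zeroʳ F) (sym (*-zeroʳ m))
      by-cases : Dec (Rough R L d) → F * ∑ m (λ s → hit s d) ≤ m * (𝟙 (Rough? R L d) * w d)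
      by-cases (no ¬rough) = ≤-reflexive (begin-equality
        F * ∑ m (λ s → hit s d)                      ≡⟨ cong (F *_) (∑-cong m (λ s _ → cong (_* 𝟙 (d ∣? g * s + 1)) (𝟙-no (Rough? R L d) ¬rough))) ⟩
        F * ∑ m (λ s → 0)                            ≡⟨ cong (F *_) (trans (∑-const m 0) (*-zeroʳ m)) ⟩
        F * 0                                        ≡⟨ vanish (w d) ⟩
        m * (0 * w d)                                ≡⟨ cong (λ x → m * (x * w d)) (𝟙-no (Rough? R L d) ¬rough) ⟨
        m * (𝟙 (Rough? R L d) * w d)                 ∎)
      by-cases (yes (1<d , d∣L , d⊥R)) = begin
        F * ∑ m (λ s → hit s d)                      ≡⟨ cong (F *_) (∑-cong m (λ s _ → trans (cong (_* 𝟙 (d ∣? g * s + 1)) rough≡1) (*-identityˡ _))) ⟩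
        F * ∑ m (λ s → 𝟙 (d ∣? g * s + 1))           ≡⟨ cong (λ x → F * ∑ x (λ s → 𝟙 (d ∣? g * s + 1))) m≡ ⟩
        F * ∑ (q * d) (λ s → 𝟙 (d ∣? g * s + 1))     ≤⟨ *-monoʳ-≤ F (count-multiples g 1 q d⊥g) ⟩
        F * q                                        ≡⟨ cong (_* q) (w-reciprocal d (<⇒≤ 1<d) d≤X) ⟨
        d * w d * q                                  ≡⟨ rearrange d (w d) q ⟩
        q * d * (1 * w d)                            ≡⟨ cong₂ (λ x y → x * (y * w d)) m≡ rough≡1 ⟨
        m * (𝟙 (Rough? R L d) * w d)                 ∎
        where
        rough≡1 : 𝟙 (Rough? R L d) ≡ 1
        rough≡1 = 𝟙-yes (Rough? R L d) (1<d , d∣L , λ {e} → d⊥R {e})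
        rearrange : ∀ d w q → d * w * q ≡ q * d * (1 * w)
        rearrange = solve-∀
        d⊥g : Coprime d g
        d⊥g = coprime-∣ ∣-refl (gcd[m,n]∣n L R) d⊥R
        d∣m : d ∣ m
        d∣m = Coprimality.coprime-divisor d⊥g (subst (d ∣_) (trans L≡ (*-comm m g)) d∣L)
        q : ℕ
        q = quotient d∣m
        m≡ : m ≡ q * d
        m≡ = m∣n⇒n≡quotient*m d∣m

  -- φ(L) ≥ (L / g) (1 - Σ 1/d) over the rough divisors d, multiplied by g F.
  φ-lower : F * L ≤ F * (g * φ L) + L * roughSum R w X L
  φ-lower = begin
    F * L                                              ≡⟨ cong (F *_) L≡ ⟩
    F * (m * g)                                        ≡⟨ *-assoc F m g ⟨
    F * m * g                                          ≤⟨ *-monoˡ-≤ g per-class ⟩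
    (F * φ L + m * S) * g                              ≡⟨ rearrange F (φ L) m S g ⟩
    F * (g * φ L) + m * g * S                          ≡⟨ cong (λ x → F * (g * φ L) + x * S) L≡ ⟨
    F * (g * φ L) + L * S                              ∎
    where
    open ≤-Reasoning
    S : ℕ
    S = roughSum R w X L
    rearrange : ∀ F p m S g → (F * p + m * S) * g ≡ F * (g * p) + m * g * S
    rearrange = solve-∀
    hits : F * ∑ (suc X) (λ d → ∑ m (λ s → hit s d)) ≤ m * S
    hits = begin
      F * ∑ (suc X) (λ d → ∑ m (λ s → hit s d))        ≡⟨ ∑-*ˡ F (suc X) _ ⟨
      ∑ (suc X) (λ d → F * ∑ m (λ s → hit s d))        ≤⟨ ∑-≤ (suc X) few ⟩
      ∑ (suc X) (λ d → m * (𝟙 (Rough? R L d) * w d))   ≡⟨ ∑-*ˡ m (suc X) _ ⟩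
      m * S                                            ∎
    per-class : F * m ≤ F * φ L + m * S
    per-class = begin
      F * m                                                                     ≡⟨ cong (F *_) (*-identityʳ m) ⟨
      F * (m * 1)                                                               ≤⟨ *-monoʳ-≤ F (∑-≥-const m (λ s _ → cover s)) ⟩
      F * ∑ m (λ s → 𝟙 (coprime? (suc (s * g)) L) + ∑ (suc X) (hit s))          ≡⟨ cong (F *_) (∑-+ m _ _) ⟩
      F * (∑ m (λ s → 𝟙 (coprime? (suc (s * g)) L)) + ∑ m (λ s → ∑ (suc X) (hit s)))
                                                                                ≡⟨ *-distribˡ-+ F _ _ ⟩
      F * ∑ m (λ s → 𝟙 (coprime? (suc (s * g)) L)) + F * ∑ m (λ s → ∑ (suc X) (hit s))
                                                                                ≤⟨ +-mono-≤ (*-monoʳ-≤ F coprime-candidates) (≤-trans (≤-reflexive (cong (F *_) (∑-swap m (suc X) hit))) hits) ⟩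
      F * φ L + m * S                                                           ∎

  φ-lower-half : .{{NonZero F}} → 2 * roughSum R w X L ≤ F → L ≤ 2 * (gcd L R * φ L)
  φ-lower-half 2S≤F = *-cancelˡ-≤ F (+-cancelʳ-≤ (F * L) _ _ (begin
    F * L + F * L                                        ≡⟨ double (F * L) ⟩
    2 * (F * L)                                          ≤⟨ *-monoʳ-≤ 2 φ-lower ⟩
    2 * (F * (g * φ L) + L * roughSum R w X L)           ≡⟨ rearrange F (g * φ L) L (roughSum R w X L) ⟩
    F * (2 * (g * φ L)) + 2 * roughSum R w X L * L       ≤⟨ +-monoʳ-≤ (F * (2 * (g * φ L))) (*-monoˡ-≤ L 2S≤F) ⟩
    F * (2 * (g * φ L)) + F * L                          ∎))
    where
    open ≤-Reasoning
    double : ∀ x → x + x ≡ 2 * x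
    double = solve-∀
    rearrange : ∀ F p L S → 2 * (F * p + L * S) ≡ F * (2 * p) + 2 * S * L
    rearrange = solve-∀

-- The mean of the rough divisor sum along a progression

-- The sum of T / d² over z < d ≤ z + N is at most T / z - T / (z + N), by
-- telescoping.
∑-quotients : ∀ {F X w} T z N → Reciprocals F X w → 1 ≤ z → z + N ≤ X →
  ∑ N (λ e → T / suc (z + e) * w (suc (z + e))) + T * w (z + N) ≤ T * w z
∑-quotients {w = w} T z zero    recip 1≤z _      = ≤-reflexive (cong (λ x → T * w x) (+-identityʳ z))
∑-quotients {F} {X} {w} T z (suc N) recip 1≤z z+N<X = begin
  ∑ N f + q * v + T * w (z + suc N)        ≡⟨ cong (λ x → ∑ N f + q * v + T * w x) (+-suc z N) ⟩
  ∑ N f + q * v + T * v                    ≡⟨ +-assoc (∑ N f) (q * v) (T * v) ⟩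
  ∑ N f + (q * v + T * v)                  ≤⟨ +-monoʳ-≤ (∑ N f) step ⟩
  ∑ N f + T * u                            ≤⟨ ∑-quotients T z N recip 1≤z (<⇒≤ d<X) ⟩
  T * w z                                  ∎
  where
  open ≤-Reasoning
  f : ℕ → ℕ
  f e = T / suc (z + e) * w (suc (z + e))
  d q u v δ : ℕ
  d = z + N
  q = T / suc d
  u = w d
  v = w (suc d)
  -- The decrement F / d - F / (d + 1) is F / (d (d + 1)).
  δ = u ∸ v
  d<X : suc d ≤ X
  d<X = ≤-trans (≤-reflexive (sym (+-suc z N))) z+N<X
  1≤d : 1 ≤ d
  1≤d = ≤-trans 1≤z (m≤m+n z N)
  instance
    d≢0 : NonZero d
    d≢0 = >-nonZero 1≤d
  du≡ : d * u ≡ v + d * v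
  du≡ = trans (recip d 1≤d (<⇒≤ d<X)) (sym (recip (suc d) (s≤s z≤n) d<X))
  v≤u : v ≤ u
  v≤u = *-cancelˡ-≤ d (≤-trans (m≤n+m (d * v) v) (≤-reflexive (sym du≡)))
  v+δ≡u : v + δ ≡ u
  v+δ≡u = m+[n∸m]≡n v≤u
  dδ≡v : d * δ ≡ v
  dδ≡v = +-cancelˡ-≡ (d * v) (d * δ) v (begin-equality
    d * v + d * δ      ≡⟨ *-distribˡ-+ d v δ ⟨
    d * (v + δ)        ≡⟨ cong (d *_) v+δ≡u ⟩
    d * u              ≡⟨ du≡ ⟩
    v + d * v          ≡⟨ +-comm v (d * v) ⟩
    d * v + v          ∎)
  step : q * v + T * v ≤ T * u
  step = begin
    q * v + T * v              ≡⟨ cong (λ x → q * x + T * v) dδ≡v ⟨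
    q * (d * δ) + T * v        ≡⟨ cong (_+ T * v) (*-assoc q d δ) ⟨
    q * d * δ + T * v          ≤⟨ +-monoˡ-≤ (T * v) (*-monoˡ-≤ δ (≤-trans (*-monoʳ-≤ q (n≤1+n d)) (m/n*n≤m T (suc d)))) ⟩
    T * δ + T * v              ≡⟨ +-comm (T * δ) (T * v) ⟩
    T * v + T * δ              ≡⟨ *-distribˡ-+ T v δ ⟨
    T * (v + δ)                ≡⟨ cong (T *_) v+δ≡u ⟩
    T * u                      ∎

-- The sum of 1 / d over z < d ≤ z + y + n is at most y + n / y.
∑-reciprocals : ∀ {F X w} z y n → Reciprocals F X w → z + (y + n) ≤ X →
  y * ∑ (y + n) (λ e → w (suc (z + e))) ≤ (y * y + n) * F
∑-reciprocals {F} {X} {w} z y n recip z+y+n≤X = begin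
  y * ∑ (y + n) f                                 ≡⟨ cong (y *_) (∑-split y n f) ⟩
  y * (∑ y f + ∑ n (λ e → f (y + e)))             ≡⟨ *-distribˡ-+ y _ _ ⟩
  y * ∑ y f + y * ∑ n (λ e → f (y + e))           ≡⟨ cong (λ x → y * ∑ y f + x) (∑-*ˡ y n _) ⟨
  y * ∑ y f + ∑ n (λ e → y * f (y + e))           ≤⟨ +-mono-≤ (*-monoʳ-≤ y (∑-≤-const y early)) (∑-≤-const n late) ⟩
  y * (y * F) + n * F                             ≡⟨ rearrange y n F ⟩
  (y * y + n) * F                                 ∎
  where
  open ≤-Reasoning
  f : ℕ → ℕ
  f e = w (suc (z + e))
  rearrange : ∀ y n F → y * (y * F) + n * F ≡ (y * y + n) * F
  rearrange = solve-∀
  multiple : ∀ e → e ℕ.< y + n → suc (z + e) * f e ≡ F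
  multiple e e<y+n = recip (suc (z + e)) (s≤s z≤n) (≤-trans (+-monoʳ-< z e<y+n) z+y+n≤X)
  early : ∀ e → e ℕ.< y → f e ≤ F
  early e e<y = ≤-trans (m≤m+n (f e) ((z + e) * f e)) (≤-reflexive (multiple e (≤-trans e<y (m≤m+n y n))))
  late : ∀ e → e ℕ.< n → y * f (y + e) ≤ F
  late e e<n = begin
    y * f (y + e)                      ≤⟨ *-monoˡ-≤ (f (y + e)) (≤-trans (m≤m+n y e) (m≤n+m (y + e) (suc z))) ⟩
    suc (z + (y + e)) * f (y + e)      ≡⟨ multiple (y + e) (+-monoʳ-< y e<n) ⟩
    F                                  ∎

module _ {R F X : ℕ} {w : ℕ → ℕ} (w-reciprocal : Reciprocals F X w) (A B z : ℕ)
  (R-coprime⇒A-coprime : ∀ d → Coprime d R → Coprime d A)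
  (small-not-rough : ∀ d → 1 ℕ.< d → d ≤ z → ¬ Coprime d R) where

  -- A rough d exceeds z and divides at most 1 + T / d of the first T terms.
  ∑-roughSum : ∀ T N → X ≡ z + N →
    ∑ T (λ t → roughSum R w X (A * t + B)) ≤ ∑ N (λ e → suc (T / suc (z + e)) * w (suc (z + e)))
  ∑-roughSum T N refl = begin
    ∑ T (λ t → roughSum R w X (A * t + B))                                        ≡⟨ ∑-swap T (suc X) _ ⟩
    ∑ (suc z + N) (λ d → ∑ T (λ t → term t d))                                    ≡⟨ ∑-split (suc z) N _ ⟩
    ∑ (suc z) (λ d → ∑ T (λ t → term t d)) + ∑ N (λ e → ∑ T (λ t → term t (suc (z + e))))
                                                                                  ≤⟨ +-mono-≤ (∑-≤-const (suc z) small) (∑-≤ N (λ e _ → large e)) ⟩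
    suc z * 0 + ∑ N (λ e → suc (T / suc (z + e)) * w (suc (z + e)))               ≡⟨ cong (_+ ∑ N (λ e → suc (T / suc (z + e)) * w (suc (z + e)))) (*-zeroʳ (suc z)) ⟩
    ∑ N (λ e → suc (T / suc (z + e)) * w (suc (z + e)))                           ∎
    where
    open ≤-Reasoning
    term : ℕ → ℕ → ℕ
    term t d = 𝟙 (Rough? R (A * t + B) d) * w d
    small : ∀ d → d ℕ.< suc z → ∑ T (λ t → term t d) ≤ 0
    small d (s≤s d≤z) = ≤-trans
      (∑-≤-const T (λ t _ → ≤-reflexive (cong (_* w d)
        (𝟙-no (Rough? R (A * t + B) d) (λ (1<d , _ , d⊥R) → small-not-rough d 1<d d≤z d⊥R)))))
      (≤-reflexive (*-zeroʳ T))
    count : ∀ d .{{_ : NonZero d}} → Dec (Coprime d R) →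
      ∑ T (λ t → 𝟙 (Rough? R (A * t + B) d)) ≤ suc (T / d)
    count d (yes d⊥R) = ≤-trans
      (∑-≤ T (λ t _ → 𝟙-mono (Rough? R (A * t + B) d) (d ∣? A * t + B) (λ (_ , d∣ , _) → d∣)))
      (count-multiples-≤ A B T (R-coprime⇒A-coprime d d⊥R))
    count d (no ¬d⊥R) = ≤-trans
      (≤-reflexive (∑-𝟙-none T (λ t → Rough? R (A * t + B) d) (λ t _ (_ , _ , d⊥R) → ¬d⊥R d⊥R))) z≤n
    large : ∀ e → ∑ T (λ t → term t (suc (z + e))) ≤ suc (T / suc (z + e)) * w (suc (z + e))
    large e = begin
      ∑ T (λ t → term t d)                               ≡⟨ ∑-cong T (λ t _ → *-comm _ (w d)) ⟩
      ∑ T (λ t → w d * 𝟙 (Rough? R (A * t + B) d))       ≡⟨ ∑-*ˡ (w d) T _ ⟩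
      w d * ∑ T (λ t → 𝟙 (Rough? R (A * t + B) d))       ≡⟨ *-comm (w d) _ ⟩
      ∑ T (λ t → 𝟙 (Rough? R (A * t + B) d)) * w d       ≤⟨ *-monoˡ-≤ (w d) (count d (coprime? d R)) ⟩
      suc (T / d) * w d                                  ∎
      where
      d : ℕ
      d = suc (z + e)

  -- The mean is at most 3 / z once T is large. The factor 3 comes from
  -- 1 / z for the sum of 1 / d², and twice 1 / z for the sum of 1 / d over
  -- d ≤ X = H T, divided by T; the latter is split at d = z + z H.
  mean-roughSum : ∀ H T → 1 ≤ H → 1 ≤ z → X ≡ H * T → z * (z * H) ≤ T → z + z * H ≤ X →
    z * ∑ T (λ t → roughSum R w X (A * t + B)) ≤ 3 * (T * F)
  mean-roughSum H T 1≤H 1≤z X≡HT zy≤T z+y≤X = begin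
    z * ∑ T (λ t → roughSum R w X (A * t + B))                        ≤⟨ *-monoʳ-≤ z (∑-roughSum T N X≡) ⟩
    z * ∑ N (λ e → suc (T / suc (z + e)) * w (suc (z + e)))           ≡⟨ cong (z *_) (∑-cong N (λ e _ → +-comm (w (suc (z + e))) _)) ⟩
    z * ∑ N (λ e → T / suc (z + e) * w (suc (z + e)) + w (suc (z + e)))
                                                                      ≡⟨ cong (z *_) (∑-+ N _ _) ⟩
    z * (S₁ + S₂)                                                     ≡⟨ *-distribˡ-+ z S₁ S₂ ⟩
    z * S₁ + z * S₂                                                   ≤⟨ +-mono-≤ bound₁ bound₂ ⟩
    T * F + 2 * (T * F)                                               ≡⟨⟩
    3 * (T * F)                                                       ∎
    where
    open ≤-Reasoning
    y n N S₁ S₂ : ℕ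
    y = z * H
    n = X ∸ (z + y)
    N = y + n
    S₁ = ∑ N (λ e → T / suc (z + e) * w (suc (z + e)))
    S₂ = ∑ N (λ e → w (suc (z + e)))
    instance
      H≢0 : NonZero H
      H≢0 = >-nonZero 1≤H
    X≡ : X ≡ z + N
    X≡ = trans (sym (m+[n∸m]≡n z+y≤X)) (+-assoc z y n)
    z≤X : z ≤ X
    z≤X = ≤-trans (m≤m+n z y) z+y≤X
    bound₁ : z * S₁ ≤ T * F
    bound₁ = begin
      z * S₁           ≤⟨ *-monoʳ-≤ z (≤-trans (m≤m+n S₁ _) (∑-quotients T z N w-reciprocal 1≤z (≤-reflexive (sym X≡)))) ⟩
      z * (T * w z)    ≡⟨ rearrange z T (w z) ⟩
      T * (z * w z)    ≡⟨ cong (T *_) (w-reciprocal z 1≤z z≤X) ⟩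
      T * F            ∎
      where
      rearrange : ∀ z T w → z * (T * w) ≡ T * (z * w)
      rearrange = solve-∀
    bound₂ : z * S₂ ≤ 2 * (T * F)
    bound₂ = *-cancelˡ-≤ H (begin
      H * (z * S₂)                       ≡⟨ rearrange₁ H z S₂ ⟩
      y * S₂                             ≤⟨ ∑-reciprocals z y n w-reciprocal (≤-reflexive (sym X≡)) ⟩
      (y * y + n) * F                    ≤⟨ *-monoˡ-≤ F (+-mono-≤ yy≤ (≤-trans (m∸n≤m X (z + y)) (≤-reflexive X≡HT))) ⟩
      (H * T + H * T) * F                ≡⟨ rearrange₂ H T F ⟩
      H * (2 * (T * F))                  ∎)
      where
      rearrange₁ : ∀ H z S → H * (z * S) ≡ z * H * S
      rearrange₁ = solve-∀
      rearrange₂ : ∀ H T F → (H * T + H * T) * F ≡ H * (2 * (T * F))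
      rearrange₂ = solve-∀
      rearrange₃ : ∀ z H → z * H * (z * H) ≡ H * (z * (z * H))
      rearrange₃ = solve-∀
      yy≤ : y * y ≤ H * T
      yy≤ = ≤-trans (≤-reflexive (rearrange₃ z H)) (*-monoʳ-≤ H zy≤T)

-- Averaging

-- A quantity whose mean over t < T is at most 3 F / 8 exceeds F / 2 for at most
-- three quarters of the t.
markov : ∀ F T (S : ℕ → ℕ) .{{_ : NonZero F}} → 8 * ∑ T S ≤ 3 * (T * F) →
  T ≤ 4 * ∑ T (λ t → 𝟙 (2 * S t ≤? F))
markov F T S mean = *-cancelˡ-≤ F (+-cancelʳ-≤ (3 * (T * F)) _ _ (begin
  F * T + 3 * (T * F)                      ≡⟨ rearrange₁ F T ⟩
  4 * (T * F)                              ≤⟨ *-monoʳ-≤ 4 total ⟩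
  4 * (F * G + 2 * ∑ T S)                  ≡⟨ rearrange₂ F G (∑ T S) ⟩
  F * (4 * G) + 8 * ∑ T S                  ≤⟨ +-monoʳ-≤ (F * (4 * G)) mean ⟩
  F * (4 * G) + 3 * (T * F)                ∎))
  where
  open ≤-Reasoning
  G : ℕ
  G = ∑ T (λ t → 𝟙 (2 * S t ≤? F))
  rearrange₁ : ∀ F T → F * T + 3 * (T * F) ≡ 4 * (T * F)
  rearrange₁ = solve-∀
  rearrange₂ : ∀ F G S → 4 * (F * G + 2 * S) ≡ F * (4 * G) + 8 * S
  rearrange₂ = solve-∀
  each : ∀ t → Dec (2 * S t ≤ F) → F ≤ F * 𝟙 (2 * S t ≤? F) + 2 * S t
  each t (yes small) = ≤-trans
    (≤-reflexive (sym (trans (cong (F *_) (𝟙-yes (2 * S t ≤? F) small)) (*-identityʳ F)))) (m≤m+n _ _)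
  each t (no ¬small) = ≤-trans (<⇒≤ (≰⇒> ¬small)) (m≤n+m _ (F * 𝟙 (2 * S t ≤? F)))
  total : T * F ≤ F * G + 2 * ∑ T S
  total = begin
    T * F                                                  ≤⟨ ∑-≥-const T (λ t _ → each t (2 * S t ≤? F)) ⟩
    ∑ T (λ t → F * 𝟙 (2 * S t ≤? F) + 2 * S t)             ≡⟨ ∑-+ T _ _ ⟩
    ∑ T (λ t → F * 𝟙 (2 * S t ≤? F)) + ∑ T (λ t → 2 * S t) ≡⟨ cong₂ _+_ (∑-*ˡ F T _) (∑-*ˡ 2 T S) ⟩
    F * G + 2 * ∑ T S                                      ∎

n∣n! : ∀ n .{{_ : NonZero n}} → n ∣ n !
n∣n! (suc n) = m∣m*n (n !)

m≤n⇒m∣n! : ∀ {m n} → .{{NonZero m}} → m ≤ n → m ∣ n !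
m≤n⇒m∣n! {m} m≤n = ∣-trans (n∣n! m) (m≤n⇒m!∣n! m≤n)

reciprocals : ∀ X → ∃[ F ] ∃[ w ] NonZero F × Reciprocals F X w
reciprocals X = X ! , w , (X !≢0) , recip
  where
  w : ℕ → ℕ
  w zero    = 0
  w (suc d) = X ! / suc d
  recip : Reciprocals (X !) X w
  recip (suc d) _ d≤X = trans (*-comm (suc d) _) (m/n*n≡m (m≤n⇒m∣n! d≤X))

-- A tower of coprime moduli

-- Q j is Q₀ D 0 ⋯ D (j - 1), and the totient ratio of D j is at most 1 / W (Q j).
-- The construction is abstract: only the properties listed here are used.
module Tower (Q₀ : ℕ) (Q₀≢0 : NonZero Q₀) (W : ℕ → ℕ) where

  abstract
    level : ℕ → Σ ℕ NonZero
    next  : ∀ j → Sparse (proj₁ (level j)) (W (proj₁ (level j)))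

    level zero    = Q₀ , Q₀≢0
    level (suc j) = proj₁ (level j) * Sparse.modulus (next j)
                  , m*n≢0 (proj₁ (level j)) (Sparse.modulus (next j)) {{proj₂ (level j)}} {{Sparse.nonZero (next j)}}

    next j = sparse (proj₁ (level j)) (W (proj₁ (level j))) {{proj₂ (level j)}}

    Q D : ℕ → ℕ
    Q j = proj₁ (level j)
    D j = Sparse.modulus (next j)

    Q-zero : Q 0 ≡ Q₀
    Q-zero = refl

    Q-suc : ∀ j → Q (suc j) ≡ Q j * D j
    Q-suc j = refl

    Q-nonZero : ∀ j → NonZero (Q j)
    Q-nonZero j = proj₂ (level j)

    D-nonZero : ∀ j → NonZero (D j)
    D-nonZero j = Sparse.nonZero (next j)

    D-coprime : ∀ j → Coprime (D j) (Q j)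
    D-coprime j = Sparse.coprime (next j)

    D-small : ∀ j → φ (D j) * W (Q j) ≤ D j
    D-small j = Sparse.φ-small (next j)

  Q-∣ : ∀ {i j} → i ≤ j → Q i ∣ Q j
  Q-∣ {i} {zero}  z≤n   = ∣-refl
  Q-∣ {i} {suc j} i≤1+j with m≤n⇒m<n∨m≡n i≤1+j
  ... | inj₁ (s≤s i≤j) = subst (Q i ∣_) (sym (Q-suc j)) (∣m⇒∣m*n (D j) (Q-∣ i≤j))
  ... | inj₂ refl      = ∣-refl

  D∣Q : ∀ {i j} → i ℕ.< j → D i ∣ Q j
  D∣Q {i} i<j = ∣-trans (subst (D i ∣_) (sym (Q-suc i)) (n∣m*n (Q i))) (Q-∣ i<j)

  -- The congruences are solved one at a time; a later step moves n by a
  -- multiple of all the earlier moduli.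
  simultaneous : (a b : ℕ → ℕ) (j : ℕ) → (∀ i → i ℕ.< j → Coprime (a i) (D i)) →
    ∃[ n ] (∀ i → i ℕ.< j → D i ∣ a i * n + b i)
  simultaneous a b zero    a⊥D = 0 , λ i ()
  simultaneous a b (suc j) a⊥D
    with simultaneous a b j (λ i i<j → a⊥D i (m<n⇒m<1+n i<j))
  ... | n , D∣ with solve-congruence {{D-nonZero j}}
                    (coprime-* (a⊥D j (n<1+n j)) (Coprimality.sym (D-coprime j))) (a j * n + b j)
  ...   | t , D∣′ = n + Q j * t , solves
    where
    rearrange : ∀ a n Q t b → a * Q * t + (a * n + b) ≡ a * (n + Q * t) + b
    rearrange = solve-∀
    solves : ∀ i → i ℕ.< suc j → D i ∣ a i * (n + Q j * t) + b i
    solves i (s≤s i≤j) with m≤n⇒m<n∨m≡n i≤j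
    ... | inj₂ refl = subst (D i ∣_) (rearrange (a i) n (Q i) t (b i)) D∣′
    ... | inj₁ i<j  = subst (D i ∣_) (rearrange (a i) n (Q j) t (b i))
          (∣m∣n⇒∣m+n (∣m⇒∣m*n t (∣n⇒∣m*n (a i) (D∣Q i<j))) (D∣ i i<j))

  -- A divisor of Q (i + e) coprime to D i, …, D (i + e - 1) divides Q i.
  coprime-descent : ∀ g i e → (∀ j → i ≤ j → j ℕ.< i + e → Coprime g (D j)) → g ∣ Q (i + e) → g ∣ Q i
  coprime-descent g i zero    g⊥D g∣ = subst (λ x → g ∣ Q x) (+-identityʳ i) g∣
  coprime-descent g i (suc e) g⊥D g∣ = coprime-descent g i e
    (λ j i≤j j<i+e → g⊥D j i≤j (≤-trans j<i+e (+-monoʳ-≤ i (n≤1+n e))))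
    (Coprimality.coprime-divisor (g⊥D (i + e) (m≤m+n i e) (+-monoʳ-< i (n<1+n e)))
      (subst (g ∣_) (trans (cong Q (+-suc i e)) (trans (Q-suc (i + e)) (*-comm (Q (i + e)) (D (i + e))))) g∣))

-- Linear forms with natural coefficients

-- The data are indexed by ℕ, but only the indices below k are constrained to
-- be independent.
module Forms (k : ℕ) (1≤k : 1 ≤ k) (a b : ℕ → ℕ) (a>0 : ∀ i → 0 ℕ.< a i) (b>0 : ∀ i → 0 ℕ.< b i)
  (independent : ∀ i j → i ℕ.< j → j ℕ.< k → a i * b j ≢ a j * b i) (K : ℕ) where

  form : ℕ → ℕ → ℕ
  form i n = a i * n + b i

  -- The inequality φ(L_i) > K φ(L_{i+1}) along the whole chain at n.
  Descends : ℕ → Set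
  Descends n = ∀ i → suc i ℕ.< k → K * φ (form (suc i) n) ℕ.< φ (form i n)

  private
    -- c bounds the quotients of two forms, κ the size of rough divisors from
    -- below, and Z! is the bottom of the tower. The value 8 k lets k sums of
    -- mean 3 / κ add up to a mean of 3 / 8.
    c κ Z : ℕ
    c = ∑ k (λ i → a i + b i)
    κ = 8 * k
    Z = κ + ∑ k a + ∑ k (λ i → ∑ k (λ j → ∣ a i * b j - a j * b i ∣))

    a≤Z : ∀ i → i ℕ.< k → a i ≤ Z
    a≤Z i i<k = ≤-trans (term≤∑ a i<k) (≤-trans (m≤n+m (∑ k a) κ) (m≤m+n (κ + ∑ k a) _))

    δ≤Z : ∀ i j → i ℕ.< k → j ℕ.< k → ∣ a i * b j - a j * b i ∣ ≤ Z
    δ≤Z i j i<k j<k = ≤-trans (term≤∑ (λ j → ∣ a i * b j - a j * b i ∣) j<k)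
      (≤-trans (term≤∑ (λ i → ∑ k (λ j → ∣ a i * b j - a j * b i ∣)) i<k) (m≤n+m _ (κ + ∑ k a)))

    form≤ : ∀ {i} n → i ℕ.< k → form i n ≤ c * suc n
    form≤ {i} n i<k = begin
      a i * n + b i                ≤⟨ +-mono-≤ (*-monoʳ-≤ (a i) (n≤1+n n)) (m≤m*n (b i) (suc n)) ⟩
      a i * suc n + b i * suc n    ≡⟨ *-distribʳ-+ (suc n) (a i) (b i) ⟨
      (a i + b i) * suc n          ≤⟨ *-monoˡ-≤ (suc n) (term≤∑ (λ i → a i + b i) i<k) ⟩
      c * suc n                    ∎
      where open ≤-Reasoning

    ≤form : ∀ i n → suc n ≤ form i n
    ≤form i n = ≤-trans (≤-reflexive (+-comm 1 n))
      (+-mono-≤ (m≤n*m n (a i) {{>-nonZero (a>0 i)}}) (b>0 i))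

    instance
      form≢0 : ∀ {i n} → NonZero (form i n)
      form≢0 {i} {n} = >-nonZero (≤-trans (s≤s z≤n) (≤form i n))

    cross-difference : ∀ i j n → ∣ a i * form j n - a j * form i n ∣ ≡ ∣ a i * b j - a j * b i ∣
    cross-difference i j n = trans
      (cong₂ ∣_-_∣ (left (a i) (a j) n (b j)) (right (a i) (a j) n (b i)))
      (∣m+n-m+o∣≡∣n-o∣ (a i * a j * n) (a i * b j) (a j * b i))
      where
      left : ∀ x y n b → x * (y * n + b) ≡ x * y * n + x * b
      left = solve-∀
      right : ∀ x y n b → y * (x * n + b) ≡ x * y * n + y * b
      right = solve-∀

    -- The weight makes φ(D_{i+1}) / D_{i+1} smaller than 1 / (2 c K Q_{i+1}), the
    -- factor 2 c Q_{i+1} being lost in the comparison of L_{i+1} with φ(L_i).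
    open Tower (Z !) (Z !≢0) (λ q → suc (2 * c * K * q))

    ∣Q : ∀ {m} j → .{{NonZero m}} → m ≤ Z → m ∣ Q j
    ∣Q {m} j m≤Z = ∣-trans (subst (m ∣_) (sym Q-zero) (m≤n⇒m∣n! m≤Z)) (Q-∣ {0} {j} z≤n)

    a∣Q : ∀ {i} j → i ℕ.< k → a i ∣ Q j
    a∣Q {i} j i<k = ∣Q j {{>-nonZero (a>0 i)}} (a≤Z i i<k)

    R : ℕ
    R = Q k

    instance
      R≢0 : NonZero R
      R≢0 = Q-nonZero k

    -- A common divisor of two forms divides |a_i b_j - a_j b_i|, hence Z!.
    forms-coprime : ∀ i j n → i ℕ.< j → j ℕ.< k → D j ∣ form j n → Coprime (form i n) (D j)
    forms-coprime i j n i<j j<k D∣form {e} (e∣i , e∣D) = D-coprime j (e∣D , e∣Q)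
      where
      e∣δ : e ∣ ∣ a i * b j - a j * b i ∣
      e∣δ = subst (e ∣_) (cross-difference i j n)
        (∣-∣-∣ (∣n⇒∣m*n (a i) (∣-trans e∣D D∣form)) (∣n⇒∣m*n (a j) e∣i))
      e∣Q : e ∣ Q j
      e∣Q = ∣-trans e∣δ (∣Q j {{ℕ.≢-nonZero (independent i j i<j j<k ∘ ∣m-n∣≡0⇒m≡n)}}
              (δ≤Z i j (<-trans i<j j<k) j<k))

    gcd∣Q : ∀ i n → i ℕ.< k → (∀ j → j ℕ.< k → D j ∣ form j n) → gcd (form i n) R ∣ Q (suc i)
    gcd∣Q i n i<k D∣ = coprime-descent (gcd (form i n) R) (suc i) (k ∸ suc i)
      (λ j i<j j< → let j<k = ≤-trans j< (≤-reflexive (m+[n∸m]≡n i<k)) in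
        coprime-∣ (gcd[m,n]∣m (form i n) R) ∣-refl (forms-coprime i j n i<j j<k (D∣ j j<k)))
      (subst (λ x → gcd (form i n) R ∣ Q x) (sym (m+[n∸m]≡n i<k)) (gcd[m,n]∣n (form i n) R))

    φ-upper : ∀ j n → D j ∣ form j n → suc (2 * c * K * Q j) * φ (form j n) ≤ form j n
    φ-upper j n D∣ = *-cancelʳ-≤ _ _ (D j) {{D-nonZero j}} (begin
      W * φ L * D j        ≡⟨ rearrange₁ W (φ L) (D j) ⟩
      W * (D j * φ L)      ≤⟨ *-monoʳ-≤ W (φ-∣-≤ D∣) ⟩
      W * (L * φ (D j))    ≡⟨ rearrange₂ W L (φ (D j)) ⟩
      L * (φ (D j) * W)    ≤⟨ *-monoʳ-≤ L (D-small j) ⟩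
      L * D j              ∎)
      where
      open ≤-Reasoning
      L W : ℕ
      L = form j n
      W = suc (2 * c * K * Q j)
      rearrange₁ : ∀ W p D → W * p * D ≡ W * (D * p)
      rearrange₁ = solve-∀
      rearrange₂ : ∀ W L p → W * (L * p) ≡ L * (p * W)
      rearrange₂ = solve-∀

    -- The two estimates combined; `lower` is what holds on average.
    descends : ∀ n → (∀ j → j ℕ.< k → D j ∣ form j n) →
      (∀ i → i ℕ.< k → form i n ≤ 2 * (gcd (form i n) R * φ (form i n))) → Descends n
    descends n D∣ lower i 1+i<k = *-cancelˡ-< (2 * c * q) (K * p′) p (begin-strict
      2 * c * q * (K * p′)             ≡⟨ rearrange₁ c q K p′ ⟩
      2 * c * K * q * p′               <⟨ m<n+m _ p′>0 ⟩
      suc (2 * c * K * q) * p′         ≤⟨ φ-upper (suc i) n (D∣ (suc i) 1+i<k) ⟩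
      form (suc i) n                   ≤⟨ form≤ n 1+i<k ⟩
      c * suc n                        ≤⟨ *-monoʳ-≤ c (≤form i n) ⟩
      c * form i n                     ≤⟨ *-monoʳ-≤ c (lower i i<k) ⟩
      c * (2 * (gcd (form i n) R * p)) ≤⟨ *-monoʳ-≤ c (*-monoʳ-≤ 2 (*-monoˡ-≤ p (∣⇒≤ {{Q-nonZero (suc i)}} (gcd∣Q i n i<k D∣)))) ⟩
      c * (2 * (q * p))                ≡⟨ rearrange₂ c q p ⟩
      2 * c * q * p                    ∎)
      where
      open ≤-Reasoning
      i<k : i ℕ.< k
      i<k = <-trans (n<1+n i) 1+i<k
      q p p′ : ℕ
      q = Q (suc i)
      p = φ (form i n)
      p′ = φ (form (suc i) n)
      p′>0 : 0 ℕ.< p′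
      p′>0 = >-nonZero⁻¹ p′ {{φ-nonZero (form (suc i) n)}}
      rearrange₁ : ∀ c q K p → 2 * c * q * (K * p) ≡ 2 * c * K * q * p
      rearrange₁ = solve-∀
      rearrange₂ : ∀ c q p → c * (2 * (q * p)) ≡ 2 * c * q * p
      rearrange₂ = solve-∀

    abstract
      solution : ∃[ n ] (∀ i → i ℕ.< k → D i ∣ a i * n + b i)
      solution = simultaneous a b k (λ i i<k → Coprimality.sym (coprime-∣ ∣-refl (a∣Q i i<k) (D-coprime i)))

    -- H T bounds all forms at the first T points of the class.
    n₀ H : ℕ
    n₀ = proj₁ solution
    H = c * (n₀ + R)

    1≤H : 1 ≤ H
    1≤H = *-mono-≤ {1} {c} {1} (≤-trans (a>0 0) (≤-trans (m≤m+n (a 0) (b 0)) (term≤∑ (λ i → a i + b i) 1≤k)))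
      (≤-trans (>-nonZero⁻¹ R) (m≤n+m R n₀))

    -- The points of the residue class n₀ modulo R.
    point : ℕ → ℕ
    point t = n₀ + R * t

    D∣form : ∀ t j → j ℕ.< k → D j ∣ form j (point t)
    D∣form t j j<k = subst (D j ∣_) (rearrange (a j) n₀ R t (b j))
      (∣m∣n⇒∣m+n (∣m⇒∣m*n t (∣n⇒∣m*n (a j) (D∣Q j<k))) (proj₂ solution j j<k))
      where
      rearrange : ∀ a n Q t b → a * Q * t + (a * n + b) ≡ a * (n + Q * t) + b
      rearrange = solve-∀

    point< : ∀ {t T} → t ℕ.< T → point t ℕ.< (n₀ + R) * T
    point< {t} {T} t<T = begin
      suc (n₀ + R * t)               ≤⟨ s≤s (m≤m+n _ (n₀ * t)) ⟩
      1 + (n₀ + R * t + n₀ * t)      ≤⟨ +-monoˡ-≤ _ (>-nonZero⁻¹ R) ⟩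
      R + (n₀ + R * t + n₀ * t)      ≡⟨ rearrange R n₀ t ⟩
      (n₀ + R) * suc t               ≤⟨ *-monoʳ-≤ (n₀ + R) t<T ⟩
      (n₀ + R) * T                   ∎
      where
      open ≤-Reasoning
      rearrange : ∀ R n t → R + (n + R * t + n * t) ≡ (n + R) * (1 + t)
      rearrange = solve-∀

    T₀ : ℕ
    T₀ = κ * (κ * H) + (κ + κ * H)

    module Range (T : ℕ) (T₀≤T : T₀ ≤ T) (F : ℕ) (w : ℕ → ℕ) (F≢0 : NonZero F)
      (w-reciprocal : Reciprocals F (H * T) w) where

      X : ℕ
      X = H * T

      instance
        k≢0 : NonZero k
        k≢0 = >-nonZero 1≤k

      -- One sum over all forms, so that a single exceptional set suffices.
      roughTotal : ℕ → ℕ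
      roughTotal t = ∑ k (λ i → roughSum R w X (form i (point t)))

      mean-form : ∀ i → i ℕ.< k → κ * ∑ T (λ t → roughSum R w X (form i (point t))) ≤ 3 * (T * F)
      mean-form i i<k = ≤-trans
        (≤-reflexive (cong (κ *_) (∑-cong T (λ t _ → cong (roughSum R w X) (rearrange (a i) n₀ R t (b i))))))
        (mean-roughSum w-reciprocal (a i * R) (form i n₀) κ R⊥⇒A⊥ small H T 1≤H
          (≤-trans 1≤k (m≤n*m k 8)) refl (≤-trans (m≤m+n _ _) T₀≤T)
          (≤-trans (≤-trans (m≤n+m _ (κ * (κ * H))) T₀≤T) (m≤n*m T H {{>-nonZero 1≤H}})))
        where
        rearrange : ∀ a n Q t b → a * (n + Q * t) + b ≡ a * Q * t + (a * n + b)
        rearrange = solve-∀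
        R⊥⇒A⊥ : ∀ d → Coprime d R → Coprime d (a i * R)
        R⊥⇒A⊥ d d⊥R = Coprimality.sym (coprime-*
          (Coprimality.sym (coprime-∣ ∣-refl (a∣Q k i<k) d⊥R)) (Coprimality.sym d⊥R))
        small : ∀ d → 1 ℕ.< d → d ≤ κ → ¬ Coprime d R
        small d 1<d d≤κ d⊥R = <⇒≢ 1<d (sym (d⊥R (∣-refl , ∣Q k {{>-nonZero (<⇒≤ 1<d)}}
          (≤-trans d≤κ (≤-trans (m≤m+n κ (∑ k a)) (m≤m+n (κ + ∑ k a) _))))))

      mean-total : 8 * ∑ T roughTotal ≤ 3 * (T * F)
      mean-total = *-cancelˡ-≤ k (begin
        k * (8 * ∑ T roughTotal)            ≡⟨ rearrange k (∑ T roughTotal) ⟩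
        κ * ∑ T roughTotal                  ≡⟨ cong (κ *_) (∑-swap T k _) ⟩
        κ * ∑ k (λ i → ∑ T (λ t → roughSum R w X (form i (point t))))
                                            ≡⟨ ∑-*ˡ κ k _ ⟨
        ∑ k (λ i → κ * ∑ T (λ t → roughSum R w X (form i (point t))))
                                            ≤⟨ ∑-≤-const k mean-form ⟩
        k * (3 * (T * F))                   ∎)
        where
        open ≤-Reasoning
        rearrange : ∀ k S → k * (8 * S) ≡ 8 * k * S
        rearrange = solve-∀

      Good : ℕ → Set
      Good t = 2 * roughTotal t ≤ F

      Good? : Decidable Good
      Good? t = 2 * roughTotal t ≤? F

      good-count : T ≤ 4 * ∑ T (λ t → 𝟙 (Good? t))
      good-count = markov F T roughTotal {{F≢0}} mean-total

      good-descends : ∀ t → t ℕ.< T → Good t → Descends (point t)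
      good-descends t t<T good = descends (point t) (D∣form t) lower
        where
        lower : ∀ i → i ℕ.< k →
          form i (point t) ≤ 2 * (gcd (form i (point t)) R * φ (form i (point t)))
        lower i i<k = φ-lower-half R F X (form i (point t)) w w-reciprocal form≤X {{F≢0}}
          (≤-trans (*-monoʳ-≤ 2 (term≤∑ (λ i → roughSum R w X (form i (point t))) i<k)) good)
          where
          form≤X : form i (point t) ≤ X
          form≤X = ≤-trans (form≤ (point t) i<k)
            (≤-trans (*-monoʳ-≤ c (point< t<T)) (≤-reflexive (sym (*-assoc c (n₀ + R) T))))

  abstract
    -- Among the integers below P T at least T / 4 satisfy Descends.
    descends-frequently : ∃[ P ] 1 ≤ P × ∃[ T₀ ] (∀ T → T₀ ≤ T →
      ∃[ ns ] T ≤ 4 * length ns × Unique ns × All (λ n → n ℕ.< P * T × Descends n) ns)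
    descends-frequently = n₀ + R , ≤-trans (>-nonZero⁻¹ R) (m≤n+m R n₀) , T₀ , frequent
      where
      frequent : ∀ T → T₀ ≤ T →
        ∃[ ns ] T ≤ 4 * length ns × Unique ns × All (λ n → n ℕ.< (n₀ + R) * T × Descends n) ns
      frequent T T₀≤T = from-weights (reciprocals (H * T))
        where
        from-weights : ∃[ F ] ∃[ w ] NonZero F × Reciprocals F (H * T) w →
          ∃[ ns ] T ≤ 4 * length ns × Unique ns × All (λ n → n ℕ.< (n₀ + R) * T × Descends n) ns
        from-weights (F , w , F≢0 , w-reciprocal) = map point ts , long , distinct , descending
          where
          open Range T T₀≤T F w F≢0 w-reciprocal
          ts : List ℕ
          ts = filter Good? (upTo T)
          long : T ≤ 4 * length (map point ts)
          long = subst (λ x → T ≤ 4 * x)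
            (sym (trans (length-map point ts) (length-filter-applyUpTo T (λ t → t) Good?))) good-count
          distinct : Unique (map point ts)
          distinct = Unique.map⁺ (λ {s} {t} eq → *-cancelˡ-≡ s t R (+-cancelˡ-≡ n₀ _ _ eq))
            (Unique.filter⁺ Good? (Unique.upTo⁺ T))
          descending : All (λ n → n ℕ.< (n₀ + R) * T × Descends n) (map point ts)
          descending = All.map⁺ (AllBase.map (λ {t} (t<T , good) → point< t<T , good-descends t t<T good)
            (AllBase.zip (All.filter⁺ Good? (All.applyUpTo⁺₁ (λ t → t) T (λ t<T → t<T)) , All.all-filter Good? (upTo T))))

-- From lists to lower density

/-≤-/ : ∀ a b c d .{{_ : NonZero b}} .{{_ : NonZero d}} → a * d ≤ c * b →
  + a ℚ./ b ℚ.≤ + c ℚ./ d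
/-≤-/ a (suc b) c (suc d) ad≤cb = ℚ.toℚᵘ-cancel-≤
  (ℚᵘ.≤-respˡ-≃ (ℚᵘ.≃-sym (ℚ.toℚᵘ-fromℚᵘ (ℚᵘ.mkℚᵘ (+ a) b)))
    (ℚᵘ.≤-respʳ-≃ (ℚᵘ.≃-sym (ℚ.toℚᵘ-fromℚᵘ (ℚᵘ.mkℚᵘ (+ c) d)))
      (ℚᵘ.*≤* (subst₂ ℤ._≤_ (ℤ.pos-* a (suc d)) (ℤ.pos-* c (suc b)) (ℤ.+≤+ ad≤cb)))))

-- The absolute value allows negative q at no cost.
<-/ : ∀ q m n .{{_ : NonZero n}} → ℤ.∣ ℚ.↥ q ∣ * n ℕ.< m → q ℚ.< + m ℚ./ n
<-/ q@record{} m (suc n) qn<m = ℚ.toℚᵘ-cancel-<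
  (ℚᵘ.<-respʳ-≃ (ℚᵘ.≃-sym (ℚ.toℚᵘ-fromℚᵘ (ℚᵘ.mkℚᵘ (+ m) n)))
    (ℚᵘ.*<* (ℤ.≤-<-trans numerator≤ (ℤ.<-≤-trans (ℤ.+<+ qn<m) m≤))))
  where
  ≤∣∣ : ∀ z → z ℤ.≤ + ℤ.∣ z ∣
  ≤∣∣ (+ n)      = ℤ.≤-refl
  ≤∣∣ ℤ.-[1+ n ] = ℤ.-≤+
  numerator≤ : ℚ.↥ q ℤ.* + suc n ℤ.≤ + (ℤ.∣ ℚ.↥ q ∣ * suc n)
  numerator≤ = ℤ.≤-trans (ℤ.*-monoʳ-≤-nonNeg (+ suc n) (≤∣∣ (ℚ.↥ q)))
    (ℤ.≤-reflexive (sym (ℤ.pos-* ℤ.∣ ℚ.↥ q ∣ (suc n))))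
  m≤ : + m ℤ.≤ + m ℤ.* ℚ.↧ q
  m≤ = ℤ.≤-trans (ℤ.+≤+ (m≤m*n m (ℚ.↧ₙ q))) (ℤ.≤-reflexive (ℤ.pos-* m (ℚ.↧ₙ q)))

<-φ-ratio : ∀ q y z .{{_ : ℤ.Positive y}} .{{_ : ℤ.Positive z}} →
  ℤ.∣ ℚ.↥ q ∣ * φ⁺ z ℕ.< φ⁺ y → q ℚ.< φ-ratio y z
<-φ-ratio q y z = <-/ q (φ⁺ y) (φ⁺ z) {{φ⁺-nonZero z}}

-- If the integers up to P T contain T / 4 elements of S, the lower density is at
-- least 1 / (4 P); the bound 1 / (8 P) absorbs the rounding of x / P.
positive-lowerDensity : ∀ {S : Pred ℕ _} P T₀ → 1 ≤ P →
  (∀ T → T₀ ≤ T → ∃[ ns ] T ≤ 4 * length ns × Unique ns × All (λ n → 1 ≤ n × n ≤ P * T × S n) ns) →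
  PositiveLowerDensity S
positive-lowerDensity {S} P@(suc _) T₀ 1≤P lists =
  + 1 ℚ./ (8 * P) , <-/ 0ℚ 1 (8 * P) (s≤s z≤n) , P * suc T₀ , bound
  where
  open ≤-Reasoning
  rearrange : ∀ m P → 4 * m * P + 4 * m * P ≡ m * (8 * P)
  rearrange = solve-∀
  bound : ∀ x → .{{_ : NonZero x}} → P * suc T₀ ≤ x →
    ∃[ m ] AtLeast m S x × + 1 ℚ./ (8 * P) ℚ.≤ + m ℚ./ x
  bound x N≤x with lists (x / P) (<⇒≤ T₀<T)
    where
    T₀<T : T₀ ℕ.< x / P
    T₀<T = ≤-trans (≤-reflexive (sym (trans (cong (_/ P) (*-comm P (suc T₀))) (m*n/n≡m (suc T₀) P)))) (/-monoˡ-≤ P N≤x)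
  ... | ns , long , distinct , members = length ns , (ns , refl , distinct , AllBase.map (λ (1≤n , n≤ , s) → 1≤n , ≤-trans n≤ PT≤x , s) members)
      , /-≤-/ 1 (8 * P) (length ns) x x≤
    where
    T : ℕ
    T = x / P
    PT≤x : P * T ≤ x
    PT≤x = ≤-trans (≤-reflexive (*-comm P T)) (m/n*n≤m x P)
    1≤T : 1 ≤ T
    1≤T = m≥n⇒m/n>0 (≤-trans (m≤m*n P (suc T₀)) N≤x)
    x≤ : 1 * x ≤ length ns * (8 * P)
    x≤ = begin
      1 * x                                        ≡⟨ trans (*-identityˡ x) (m≡m%n+[m/n]*n x P) ⟩
      x % P + T * P                                ≤⟨ +-monoˡ-≤ (T * P) (<⇒≤ (m%n<n x P)) ⟩
      P + T * P                                    ≤⟨ +-monoˡ-≤ (T * P) (m≤n*m P T {{>-nonZero 1≤T}}) ⟩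
      T * P + T * P                                ≤⟨ +-mono-≤ (*-monoˡ-≤ P long) (*-monoˡ-≤ P long) ⟩
      4 * length ns * P + 4 * length ns * P        ≡⟨ rearrange (length ns) P ⟩
      length ns * (8 * P)                          ∎

-- Reduction to natural coefficients

-- A finite family continued by a default value.
extend : ∀ {A : Set} {k} → A → (Fin k → A) → ℕ → A
extend {k = k} d f i with i <? k
... | yes i<k = f (fromℕ< i<k)
... | no  _   = d

extend-toℕ : ∀ {A : Set} {k} (d : A) (f : Fin k → A) i → extend d f (toℕ i) ≡ f i
extend-toℕ {k = k} d f i with toℕ i <? k
... | yes i<k = cong f (fromℕ<-toℕ i i<k)
... | no  i≮k = ⊥-elim (i≮k (toℕ<n i))

extend-∀ : ∀ {A : Set} {k} {P : A → Set} (d : A) (f : Fin k → A) → P d → (∀ i → P (f i)) →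
  ∀ i → P (extend d f i)
extend-∀ {k = k} d f pd pf i with i <? k
... | yes i<k = pf (fromℕ< i<k)
... | no  _   = pd

nonNegative-shift : ∀ m z → ℤ.∣ z ∣ ℕ.< m → ∃[ n ] + suc n ≡ + m ℤ.+ z
nonNegative-shift (suc m) (+ n)      _     = m + n , refl
nonNegative-shift m       ℤ.-[1+ n ] 1+n<m = m ∸ suc (suc n) , (begin
  + suc (m ∸ suc (suc n))      ≡⟨ cong +_ (sym (+-∸-assoc 1 1+n<m)) ⟩
  + (m ∸ suc n)                ≡⟨ ℤ.⊖-≥ (<⇒≤ 1+n<m) ⟨
  m ℤ.⊖ suc n                  ∎)
  where open ≡-Reasoning

-- The chain of inequalities φ(L_i) > K φ(L_{i+1}) for the original forms.
ScaledDescent : ∀ {k} → (Fin k → ℕ) → (Fin k → ℤ) → ℕ → Pred ℕ _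
ScaledDescent a b K n = Σ (AllPositive a b n) λ pos → ∀ i j → toℕ j ≡ suc (toℕ i) →
  K * φ⁺ (linear a b j n) {{pos j}} ℕ.< φ⁺ (linear a b i n) {{pos i}}

module _ (k : ℕ) (2≤k : 2 ≤ k) (a : Fin k → ℕ) (b : Fin k → ℤ) (a>0 : ∀ i → 0 ℕ.< a i)
  (independent : ∀ i j → i < j → + a i ℤ.* b j ≢ + a j ℤ.* b i) where

  private
    1≤k : 1 ≤ k
    1≤k = ≤-trans (n≤1+n 1) 2≤k

    a′ : ℕ → ℕ
    a′ = extend 1 a

    b′ : ℕ → ℤ
    b′ = extend (+ 0) b

    a′>0 : ∀ i → 0 ℕ.< a′ i
    a′>0 = extend-∀ {P = 0 ℕ.<_} 1 a (s≤s z≤n) a>0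

    -- From s onwards every form is positive; the default values 1 and 0 keep
    -- this true of the artificial forms beyond k.
    s : ℕ
    s = suc (∑ k (λ i → ℤ.∣ b′ i ∣))

    ∣b′∣<s : ∀ i → ℤ.∣ b′ i ∣ ℕ.< s
    ∣b′∣<s = extend-∀ {P = λ z → ℤ.∣ z ∣ ℕ.< s} (+ 0) b (s≤s z≤n)
      (λ i → s≤s (subst (λ z → ℤ.∣ z ∣ ≤ ∑ k (λ i → ℤ.∣ b′ i ∣)) (extend-toℕ (+ 0) b i)
        (term≤∑ (λ i → ℤ.∣ b′ i ∣) (toℕ<n i))))

    shifted : ∀ i → ∃[ n ] + suc n ≡ + (a′ i * s) ℤ.+ b′ i
    shifted i = nonNegative-shift (a′ i * s) (b′ i)
      (≤-trans (∣b′∣<s i) (m≤n*m s (a′ i) {{>-nonZero (a′>0 i)}}))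

    abstract
      -- The constant terms after translation by s.
      β : ℕ → ℕ
      β i = suc (proj₁ (shifted i))

      β>0 : ∀ i → 0 ℕ.< β i
      β>0 i = s≤s z≤n

      β≡ : ∀ i → + β i ≡ + (a′ i * s) ℤ.+ b′ i
      β≡ i = proj₂ (shifted i)

    β≡a*s+b : ∀ i → + β (toℕ i) ≡ + a i ℤ.* + s ℤ.+ b i
    β≡a*s+b i = trans (β≡ (toℕ i)) (cong₂ ℤ._+_
      (trans (cong (λ x → + (x * s)) (extend-toℕ 1 a i)) (ℤ.pos-* (a i) s)) (extend-toℕ (+ 0) b i))

    β-independent-Fin : ∀ i j → i < j → a i * β (toℕ j) ≢ a j * β (toℕ i)
    β-independent-Fin i j i<j eq = independent i j i<j
      (Group.∙-cancelˡ (AbelianGroup.group ℤ.+-0-abelianGroup) (+ a i ℤ.* + a j ℤ.* + s) _ _ (begin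
        x ℤ.* y ℤ.* σ ℤ.+ x ℤ.* b j         ≡⟨ left x y σ (b j) ⟩
        x ℤ.* (y ℤ.* σ ℤ.+ b j)             ≡⟨ cong (x ℤ.*_) (β≡a*s+b j) ⟨
        x ℤ.* + β (toℕ j)                   ≡⟨ ℤ.pos-* (a i) (β (toℕ j)) ⟨
        + (a i * β (toℕ j))                 ≡⟨ cong +_ eq ⟩
        + (a j * β (toℕ i))                 ≡⟨ ℤ.pos-* (a j) (β (toℕ i)) ⟩
        y ℤ.* + β (toℕ i)                   ≡⟨ cong (y ℤ.*_) (β≡a*s+b i) ⟩
        y ℤ.* (x ℤ.* σ ℤ.+ b i)             ≡⟨ right x y σ (b i) ⟩
        x ℤ.* y ℤ.* σ ℤ.+ y ℤ.* b i         ∎))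
      where
      open ≡-Reasoning
      x y σ : ℤ
      x = + a i
      y = + a j
      σ = + s
      left : ∀ x y s b → x ℤ.* y ℤ.* s ℤ.+ x ℤ.* b ≡ x ℤ.* (y ℤ.* s ℤ.+ b)
      left = ℤ-Solver.solve-∀
      right : ∀ x y s b → y ℤ.* (x ℤ.* s ℤ.+ b) ≡ x ℤ.* y ℤ.* s ℤ.+ y ℤ.* b
      right = ℤ-Solver.solve-∀

    β-independent : ∀ i j → i ℕ.< j → j ℕ.< k → a′ i * β j ≢ a′ j * β i
    β-independent i j i<j j<k eq = β-independent-Fin i° j° i°<j° (begin
      a i° * β (toℕ j°)            ≡⟨ cong₂ _*_ (extend-toℕ 1 a i°) refl ⟨
      a′ (toℕ i°) * β (toℕ j°)     ≡⟨ cong₂ (λ m n → a′ m * β n) (toℕ-fromℕ< i<k) (toℕ-fromℕ< j<k) ⟩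
      a′ i * β j                   ≡⟨ eq ⟩
      a′ j * β i                   ≡⟨ cong₂ (λ m n → a′ m * β n) (toℕ-fromℕ< j<k) (toℕ-fromℕ< i<k) ⟨
      a′ (toℕ j°) * β (toℕ i°)     ≡⟨ cong₂ _*_ (extend-toℕ 1 a j°) refl ⟩
      a j° * β (toℕ i°)            ∎)
      where
      open ≡-Reasoning
      i<k : i ℕ.< k
      i<k = <-trans i<j j<k
      i° j° : Fin k
      i° = fromℕ< i<k
      j° = fromℕ< j<k
      i°<j° : i° < j°
      i°<j° = subst₂ ℕ._<_ (sym (toℕ-fromℕ< i<k)) (sym (toℕ-fromℕ< j<k)) i<j

  module _ (K : ℕ) where

    open Forms k 1≤k a′ β a′>0 β>0 β-independent K using (form; Descends; descends-frequently)

    linear≡form : ∀ i n → linear a b i (s + n) ≡ + form (toℕ i) n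
    linear≡form i n = begin
      x ℤ.* + (s + n) ℤ.+ b i                        ≡⟨ cong (λ y → x ℤ.* y ℤ.+ b i) (ℤ.pos-+ s n) ⟩
      x ℤ.* (+ s ℤ.+ + n) ℤ.+ b i                    ≡⟨ rearrange x (+ s) (+ n) (b i) ⟩
      x ℤ.* + n ℤ.+ (x ℤ.* + s ℤ.+ b i)              ≡⟨ cong₂ ℤ._+_ (sym (ℤ.pos-* (a i) n)) (sym (β≡a*s+b i)) ⟩
      + (a i * n) ℤ.+ + β (toℕ i)                    ≡⟨ ℤ.pos-+ (a i * n) (β (toℕ i)) ⟨
      + (a i * n + β (toℕ i))                        ≡⟨ cong (λ y → + (y * n + β (toℕ i))) (extend-toℕ 1 a i) ⟨
      + form (toℕ i) n                               ∎
      where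
      open ≡-Reasoning
      x : ℤ
      x = + a i
      rearrange : ∀ x s n b → x ℤ.* (s ℤ.+ n) ℤ.+ b ≡ x ℤ.* n ℤ.+ (x ℤ.* s ℤ.+ b)
      rearrange = ℤ-Solver.solve-∀

    linear-positive : ∀ n → AllPositive a b (s + n)
    linear-positive n i = subst ℤ.Positive (sym (linear≡form i n))
      (ℤ.positive (ℤ.+<+ (≤-trans (β>0 (toℕ i)) (m≤n+m (β (toℕ i)) (a′ (toℕ i) * n)))))

    descends⇒scaledDescent : ∀ n → Descends n → ScaledDescent a b K (s + n)
    descends⇒scaledDescent n desc = linear-positive n , λ i j j≡1+i →
      subst₂ (λ y z → K * φ ℤ.∣ y ∣ ℕ.< φ ℤ.∣ z ∣) (sym (linear≡form j n)) (sym (linear≡form i n))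
        (subst (λ l → K * φ (form l n) ℕ.< φ (form (toℕ i) n)) (sym j≡1+i)
          (desc (toℕ i) (≤-trans (≤-reflexive (cong suc (sym j≡1+i))) (toℕ<n j))))

    scaledDescent-density : ∀ {S : Pred ℕ _} → (∀ n → ScaledDescent a b K n → S n) → PositiveLowerDensity S
    scaledDescent-density {S} imp = from-lists descends-frequently
      where
      shift : ∀ P T → 1 ≤ T → ∀ {n} → n ℕ.< P * T × Descends n → 1 ≤ s + n × s + n ≤ (s + P) * T × S (s + n)
      shift P T 1≤T {n} (n<PT , desc) =
        s≤s z≤n ,
        ≤-trans (+-mono-≤ (m≤m*n s T {{>-nonZero 1≤T}}) (<⇒≤ n<PT)) (≤-reflexive (sym (*-distribʳ-+ T s P))) ,
        imp (s + n) (descends⇒scaledDescent n desc)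
      shift-list : ∀ P T → 1 ≤ T →
        ∃[ ns ] T ≤ 4 * length ns × Unique ns × All (λ n → n ℕ.< P * T × Descends n) ns →
        ∃[ ns ] T ≤ 4 * length ns × Unique ns × All (λ n → 1 ≤ n × n ≤ (s + P) * T × S n) ns
      shift-list P T 1≤T (ns , long , distinct , members) =
        map (λ n → s + n) ns ,
        subst (λ l → T ≤ 4 * l) (sym (length-map (λ n → s + n) ns)) long ,
        Unique.map⁺ (+-cancelˡ-≡ s _ _) distinct ,
        All.map⁺ (AllBase.map (shift P T 1≤T) members)
      from-lists : ∃[ P ] 1 ≤ P × ∃[ T₀ ] (∀ T → T₀ ≤ T →
        ∃[ ns ] T ≤ 4 * length ns × Unique ns × All (λ n → n ℕ.< P * T × Descends n) ns) →
        PositiveLowerDensity S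
      from-lists (P , 1≤P , T₀ , frequent) = positive-lowerDensity (s + P) (suc T₀) (≤-trans 1≤P (m≤n+m P s))
        (λ T T₀<T → shift-list P T (≤-trans (s≤s z≤n) T₀<T) (frequent T (<⇒≤ T₀<T)))

theorem1 : ∀ (k : ℕ) → 2 ℕ.≤ k →
    (a : Fin k → ℕ) (b : Fin k → ℤ) →
    (∀ i → 0 ℕ.< a i) →
    (∀ i j → i < j → + a i ℤ.* b j ≢ + a j ℤ.* b i) →
    (∀ (C : ℝ) → 0ℚ ℚ<ℝ C → PositiveLowerDensity (RatiosExceed a b C))
    × PositiveLowerDensity (Decreasing a b)
theorem1 k 2≤k a b a>0 independent = ratios , decreasing
  where
  ratios : ∀ C → 0ℚ ℚ<ℝ C → PositiveLowerDensity (RatiosExceed a b C)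
  ratios C _ = from-bound (ℝ.upper-inhabited C)
    where
    from-bound : ∃[ q ] C ℝ<ℚ q → PositiveLowerDensity (RatiosExceed a b C)
    -- A ratio exceeding |numerator of q| ≥ q > C exceeds C.
    from-bound (q , C<q) = scaledDescent-density k 2≤k a b a>0 independent ℤ.∣ ℚ.↥ q ∣ imp
      where
      imp : ∀ n → ScaledDescent a b ℤ.∣ ℚ.↥ q ∣ n → RatiosExceed a b C n
      imp n (pos , desc) = pos , λ i j j≡1+i →
        Equivalence.from (ℝ.upper-rounded C (φ-ratio (linear a b i n) (linear a b j n) {{pos i}} {{pos j}}))
          (q , <-φ-ratio q (linear a b i n) (linear a b j n) {{pos i}} {{pos j}} (desc i j j≡1+i) , C<q)
  decreasing : PositiveLowerDensity (Decreasing a b)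
  decreasing = scaledDescent-density k 2≤k a b a>0 independent 1 imp
    where
    imp : ∀ n → ScaledDescent a b 1 n → Decreasing a b n
    imp n (pos , desc) = pos , λ i j j≡1+i →
      subst (ℕ._< φ⁺ (linear a b i n) {{pos i}}) (*-identityˡ (φ⁺ (linear a b j n) {{pos j}})) (desc i j j≡1+i)
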